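{- Let $p$ be a prime with $p\equiv 1\pmod 4$ and let $\alpha$ be a positive integer. Let $\chi$ be the unique quadratic (order $2$) Dirichlet character modulo $p^\alpha$, let $\psi$ be a Dirichlet character modulo $p^\alpha$ of order $4$, and let $J(\psi,\chi)=\sum_{x\in\mathbb{Z}_{p^\alpha}}\psi(x)\chi(1-x)$. Then $$\mathcal{K}_4(G_{p^{\alpha}})=\frac{p^{2\alpha-1}(p-1)\left[p^{2\alpha-2}\left\{(p-9)^2-2p\right\}+J(\psi,\chi)^2+\overline{J(\psi,\chi)}^2\right]}{1536}.$$
   Context: For a positive integer $n$, $\mathbb{Z}_n$ denotes the ring of integers modulo $n$ and $\mathbb{Z}_n^{\ast}$ its group of units. The graph $G_n$ has vertex set $\mathbb{Z}_n$, and two distinct vertices $a,b$ are adjacent if and only if $a-b\equiv x^2\pmod n$ for some $x\in\mathbb{Z}_n^{\ast}$. For a graph $G$, $\mathcal{K}_m(G)$ denotes the number of complete subgraphs of order $m$ in $G$. Dirichlet characters modulo $n$ are regarded as functions on $\mathbb{Z}_n$ taking the value $0$ on non-units; since $\mathbb{Z}_{p^\alpha}^{\ast}$ is cyclic, there is a unique character of order $2$ and characters of order $4$ exist. -}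

module Defs where

open import Data.Nat as ℕ using (ℕ; zero; suc)
open import Data.Nat.Divisibility as ℕD using ()
open import Data.Nat.Coprimality using (Coprime; coprime?)
open import Data.Integer as ℤ using (ℤ; +_; ∣_∣)
open import Data.Integer.Divisibility as ℤD using ()
open import Data.Fin as Fin using (Fin; toℕ)
open import Data.Fin.Properties using (any?)
open import Data.List using (List; []; _∷_; length; filter; concatMap; map; allFin; upTo; foldr)
open import Data.Product using (Σ; ∃; _×_; _,_)
open import Relation.Nullary using (¬_; Dec; yes; no)
open import Relation.Nullary.Decidable using (_×-dec_; ¬?)
open import Relation.Binary.PropositionalEquality using (_≡_; _≢_)

-- Gaussian integers ℤ[i] (the value ring of characters of order 1,2,4)

record ℤ[i] : Set where
  constructor mkℤ[i]
  field
    re : ℤ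
    im : ℤ
open ℤ[i] public

infixl 6 _+ᵍ_
infixl 7 _*ᵍ_

_+ᵍ_ : ℤ[i] → ℤ[i] → ℤ[i]
mkℤ[i] a b +ᵍ mkℤ[i] c d = mkℤ[i] (a ℤ.+ c) (b ℤ.+ d)

_*ᵍ_ : ℤ[i] → ℤ[i] → ℤ[i]
mkℤ[i] a b *ᵍ mkℤ[i] c d = mkℤ[i] (a ℤ.* c ℤ.- b ℤ.* d) (a ℤ.* d ℤ.+ b ℤ.* c)

conj : ℤ[i] → ℤ[i]
conj (mkℤ[i] a b) = mkℤ[i] a (ℤ.- b)

fromℤ : ℤ → ℤ[i]
fromℤ a = mkℤ[i] a (+ 0)

0ᵍ 1ᵍ : ℤ[i]
0ᵍ = fromℤ (+ 0)
1ᵍ = fromℤ (+ 1)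

_^ᵍ_ : ℤ[i] → ℕ → ℤ[i]
z ^ᵍ zero  = 1ᵍ
z ^ᵍ suc k = z *ᵍ (z ^ᵍ k)

sumᵍ : ℕ → (ℕ → ℤ[i]) → ℤ[i]
sumᵍ n f = foldr (λ x acc → f x +ᵍ acc) 0ᵍ (upTo n)

IsUnitMod : ℕ → ℤ → Set
IsUnitMod n a = Coprime ∣ a ∣ n

record DirichletCharacter (n : ℕ) : Set where
  field
    χ            : ℤ → ℤ[i]
    periodic     : ∀ a → χ (a ℤ.+ + n) ≡ χ a
    multiplicative : ∀ a b → χ (a ℤ.* b) ≡ χ a *ᵍ χ b
    at-one       : χ (+ 1) ≡ 1ᵍ
    vanish       : ∀ a → ¬ IsUnitMod n a → χ a ≡ 0ᵍ
open DirichletCharacter public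

HasOrder : ∀ {n} → DirichletCharacter n → ℕ → Set
HasOrder {n} c k =
  (∀ a → IsUnitMod n a → χ c a ^ᵍ k ≡ 1ᵍ) ×
  (∀ j → 1 ℕ.≤ j → j ℕ.< k → ∃ λ a → IsUnitMod n a × (χ c a ^ᵍ j ≢ 1ᵍ))

Jacobi : ∀ {n} → DirichletCharacter n → DirichletCharacter n → ℤ[i]
Jacobi {n} ψ c = sumᵍ n (λ x → χ ψ (+ x) *ᵍ χ c (+ 1 ℤ.- + x))

toℤ : ∀ {n} → Fin n → ℤ
toℤ a = + toℕ a

Adj : (n : ℕ) → Fin n → Fin n → Set
Adj n a b = (a ≢ b) ×
  ∃ λ (x : Fin n) → Coprime (toℕ x) n ×
    (+ n) ℤD.∣ (toℤ a ℤ.- toℤ b ℤ.- toℤ x ℤ.* toℤ x)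

adj? : (n : ℕ) → (a b : Fin n) → Dec (Adj n a b)
adj? n a b = ¬? (a Fin.≟ b) ×-dec
  any? (λ x → coprime? (toℕ x) n ×-dec
    (∣ + n ∣ ℕD.∣? ∣ toℤ a ℤ.- toℤ b ℤ.- toℤ x ℤ.* toℤ x ∣))

Quad : ℕ → Set
Quad n = Fin n × Fin n × Fin n × Fin n

quads : (n : ℕ) → List (Quad n)
quads n = concatMap (λ a → concatMap (λ b → concatMap (λ c →
  map (λ d → (a , b , c , d)) (allFin n)) (allFin n)) (allFin n)) (allFin n)

IsK4 : (n : ℕ) → Quad n → Set
IsK4 n (a , b , c , d) =
  (a Fin.< b × b Fin.< c × c Fin.< d) ×
  (Adj n a b × Adj n a c × Adj n a d × Adj n b c × Adj n b d × Adj n c d)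

isK4? : (n : ℕ) → (q : Quad n) → Dec (IsK4 n q)
isK4? n (a , b , c , d) =
  (a Fin.<? b ×-dec b Fin.<? c ×-dec c Fin.<? d) ×-dec
  (adj? n a b ×-dec adj? n a c ×-dec adj? n a d ×-dec
   adj? n b c ×-dec adj? n b d ×-dec adj? n c d)

K₄ : ℕ → ℕ
K₄ n = length (filter (isK4? n) (quads n))

{-# OPTIONS --safe #-}
module Submission where

-- Put q = p^(α-1) and n = p q.  By Hensel's lemma a unit u ≡ 1 mod p is a fourth power mod n, so both
-- characters, and adjacency in G_n, depend only on residues mod p; hence K₄ scales by q⁴ and J by q.
-- Modulo p the function D = 1 + η - #{x : x² = d} is nonnegative and has sum 0, so it vanishes:
-- there is only one quadratic character η, ψ² = η, and a unit d is a square iff η d = 1.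
--
-- With δ the indicator of 0 and g = 1 - δ + η (twice the indicator of the nonzero squares),
-- 64 · 24 · K₄ is the sum of ∏ g(difference) over all quadruples; translating and scaling reduces it
-- to M = ∑ g(s) g(1-s) g(t) g(1-t) g(s-t), and expanding the products gives
-- M = (p-9)² - 2p + X with X = ∑ η(s(1-s)) η(t(1-t)) η(s-t).
--
-- To see X = J² + J̄², write J² + J̄² = ∑ 2 Re ψ(xy) η(1-x) η(1-y) and replace 2 Re ψ(u) by the sum of
-- η(v) over the roots of v² = u.  The substitution x = v z turns this into
-- ∑ η(v) η(z) η(1-vz) η(z-v) = ∑ η((v + 1/v) - (z + 1/z)), and v + 1/v takes the value w
-- exactly 1 + η(w²-4) times; finally put w = 2 - 4s.

open import Defs
open import Data.Nat as ℕ using (ℕ; _^_; _∸_)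
open import Data.Nat.Primality using (Prime)
open import Data.Nat.DivMod using (_%_)
open import Data.Integer as ℤ using (+_)
open import Relation.Binary.PropositionalEquality using (_≡_)

open import Algebra.Properties.AbelianGroup using (∙-cancelˡ)
open import Data.Empty using (⊥-elim)
open import Data.Fin as Fin using (Fin; toℕ; fromℕ<)
import Data.Fin.Properties as FinP
open import Data.Integer using (ℤ; _+_; _*_; _-_; -_; _≤_; ∣_∣)
open import Data.Integer.DivMod using (_%ℕ_; _/ℕ_; n%ℕd<d; a≡a%ℕn+[a/ℕn]*n)
open import Data.Integer.Divisibility.Signed as ∣ℤ using (_∣_; divides; _∣?_; ∣ᵤ⇒∣; ∣⇒∣ᵤ)
import Data.Integer.Properties as ℤP
open import Data.Integer.Tactic.RingSolver using (solve-∀; solve)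
open import Data.List using (List; []; _∷_; length; filter; concatMap; map; allFin; tabulate; foldr; upTo; applyUpTo; _++_)
open import Data.Nat using (zero; suc)
open import Data.Nat.Coprimality using (Coprime; coprime-Bézout; coprime-divisor)
import Data.Nat.Divisibility as ℕD
open import Data.Nat.GCD using (module Bézout)
open import Data.Nat.Primality using (euclidsLemma; prime⇒nonZero; prime⇒irreducible)
import Data.Nat.Properties as ℕP
open import Data.Product using (∃; _×_; _,_; proj₁; proj₂)
open import Data.Sum using (_⊎_; inj₁; inj₂; [_,_]′)
open import Function using (_∘_; case_of_)
open import Relation.Binary.Definitions using (tri<; tri≈; tri>)
open import Relation.Binary.PropositionalEquality using (_≢_; refl; sym; trans; cong; cong₂; subst; module ≡-Reasoning)
open import Relation.Nullary using (¬_; Dec; yes; no)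
open import Relation.Nullary.Decidable using (_×-dec_)
open ≡-Reasoning

-- Finite sums

-- Residues are plain integers, and functions on residues are periodic functions of an integer. A
-- change of variables is made with δ as a kernel: `f (φ x)` becomes the sum over y of
-- `δ (y - φ x) * f y`, the two sums are exchanged, and only the equivalence of two divisibilities
-- remains to be checked. No permutation of a finite set is ever built. Characters take values in
-- ℤ[i], yet the computation stays in ℤ. With J = q (A + B i) one has J² + J̄² = 2 q² (A² - B²), and
-- since ψ is multiplicative this involves ψ only through Re ψ(xy). If u = v² is a nonzero square,
-- then ψ(u) = ψ(v)² = η(v) for either root v; if u is a nonsquare, then ψ(u)² = η(u) = -1, so ψ(u)
-- = ±i has real part 0, in agreement with the empty set of roots. This is why 2 Re ψ is a sum over
-- square roots, and why nothing quartic survives in X. The constant 1536 is 64 · 24: one factor 2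
-- for each of the six edges, and 24 orders of four vertices.

opaque
  -- Summands live on all of ℤ although only 0, ..., n - 1 are visited, so that reflections,
  -- scalings and differences of indices need no reduction modulo n.
  ∑ : ℕ → (ℤ → ℤ) → ℤ
  ∑ zero    f = + 0
  ∑ (suc n) f = f (+ 0) + ∑ n (λ x → f (+ 1 + x))

syntax ∑ n (λ x → e) = ∑[ x < n ] e
infix 5 ∑

opaque
  unfolding ∑

  ∑-cong : ∀ {n f g} → (∀ x → f x ≡ g x) → ∑ n f ≡ ∑ n g
  ∑-cong {zero}  e = refl
  ∑-cong {suc n} e = cong₂ _+_ (e (+ 0)) (∑-cong {n} (λ x → e (+ 1 + x)))

  ∑-zero : ∀ {n} → ∑[ _ < n ] + 0 ≡ + 0
  ∑-zero {zero}  = refl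
  ∑-zero {suc n} = trans (ℤP.+-identityˡ _) (∑-zero {n})

  ∑-one : ∀ {n} → ∑[ _ < n ] + 1 ≡ + n
  ∑-one {zero}  = refl
  ∑-one {suc n} = cong (λ z → + 1 + z) (∑-one {n})

  +-interchange : ∀ a b c d → (a + b) + (c + d) ≡ (a + c) + (b + d)
  +-interchange = solve-∀

  ∑-distrib-+ : ∀ {n} f g → ∑[ x < n ] (f x + g x) ≡ ∑ n f + ∑ n g
  ∑-distrib-+ {zero}  f g = refl
  ∑-distrib-+ {suc n} f g =
    trans (cong (ℤ._+_ (f (+ 0) + g (+ 0))) (∑-distrib-+ {n} (λ x → f (+ 1 + x)) (λ x → g (+ 1 + x))))
          (+-interchange (f (+ 0)) (g (+ 0)) _ _)

  ∑-*ˡ : ∀ {n} k f → ∑[ x < n ] (k * f x) ≡ k * ∑ n f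
  ∑-*ˡ {zero}  k f = sym (ℤP.*-zeroʳ k)
  ∑-*ˡ {suc n} k f =
    trans (cong (ℤ._+_ (k * f (+ 0))) (∑-*ˡ {n} k (λ x → f (+ 1 + x)))) (sym (ℤP.*-distribˡ-+ k _ _))

  ∑-comm : ∀ {m n} (f : ℤ → ℤ → ℤ) → (∑[ x < m ] ∑[ y < n ] f x y) ≡ (∑[ y < n ] ∑[ x < m ] f x y)
  ∑-comm {zero}  {n} f = sym (∑-zero {n})
  ∑-comm {suc m} {n} f =
    trans (cong (ℤ._+_ (∑ n (f (+ 0)))) (∑-comm {m} {n} (λ x → f (+ 1 + x))))
          (sym (∑-distrib-+ {n} (f (+ 0)) _))

  ∑-++ : ∀ m n {f} → ∑ (m ℕ.+ n) f ≡ ∑ m f + (∑[ x < n ] f (+ m + x))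
  ∑-++ zero    n {f} = trans (∑-cong {n} (λ x → cong f (sym (ℤP.+-identityˡ x)))) (sym (ℤP.+-identityˡ _))
  ∑-++ (suc m) n {f} = begin
    f (+ 0) + ∑ (m ℕ.+ n) f₁                       ≡⟨ cong (ℤ._+_ (f (+ 0))) (∑-++ m n) ⟩
    f (+ 0) + (∑ m f₁ + (∑[ x < n ] f₁ (+ m + x))) ≡⟨ ℤP.+-assoc (f (+ 0)) _ _ ⟨
    f (+ 0) + ∑ m f₁ + (∑[ x < n ] f₁ (+ m + x))
      ≡⟨ cong (ℤ._+_ (f (+ 0) + ∑ m f₁)) (∑-cong {n} (λ x → cong f (ℤP.+-assoc (+ 1) (+ m) x))) ⟨
    f (+ 0) + ∑ m f₁ + (∑[ x < n ] f (+ suc m + x)) ∎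
    where
    f₁ : ℤ → ℤ
    f₁ x = f (+ 1 + x)

  ∑-single : ∀ {n f} (r : Fin n) → (∀ i → i ≢ r → f (+ toℕ i) ≡ + 0) → ∑ n f ≡ f (+ toℕ r)
  ∑-single {suc n} {f} Fin.zero z = trans (cong (ℤ._+_ (f (+ 0))) (all-zero n (λ i → z (Fin.suc i) λ ()))) (ℤP.+-identityʳ _)
    where
    all-zero : ∀ n {f} → (∀ (i : Fin n) → f (+ toℕ i) ≡ + 0) → ∑ n f ≡ + 0
    all-zero zero    z = refl
    all-zero (suc n) z = cong₂ _+_ (z Fin.zero) (all-zero n (z ∘ Fin.suc))
  ∑-single {suc n} {f} (Fin.suc r) z = begin
    f (+ 0) + ∑ n (λ x → f (+ 1 + x))
      ≡⟨ cong₂ _+_ (z Fin.zero λ ()) (∑-single r λ i i≢r → z (Fin.suc i) (i≢r ∘ FinP.suc-injective)) ⟩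
    + 0 + f (+ suc (toℕ r)) ≡⟨ ℤP.+-identityˡ _ ⟩
    f (+ suc (toℕ r))       ∎

  -- Turns counting into existence: a nonzero number of solutions, written as a sum of indicators,
  -- yields a solution.
  ∑-support : ∀ {n f} → ∑ n f ≢ + 0 → ∃ λ (i : Fin n) → f (+ toℕ i) ≢ + 0
  ∑-support {zero} s = ⊥-elim (s refl)
  ∑-support {suc n} {f} s with f (+ 0) ℤ.≟ + 0
  ... | no f₀ = Fin.zero , f₀
  ... | yes f₀ with ∑-support {n} {λ x → f (+ 1 + x)} (λ e → s (cong₂ _+_ f₀ e))
  ...   | i , fᵢ = Fin.suc i , fᵢ

  ∑-nonneg : ∀ {n f} → (∀ x → + 0 ≤ f x) → + 0 ≤ ∑ n f
  ∑-nonneg {zero}  f≥0 = ℤP.≤-refl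
  ∑-nonneg {suc n} f≥0 = ℤP.+-mono-≤ (f≥0 (+ 0)) (∑-nonneg {n} (λ x → f≥0 (+ 1 + x)))

  -- The head is at most the total because the tail is nonnegative, so it is squeezed to 0; the tail
  -- then has sum 0 as well.
  ∑-nonneg-zero : ∀ {n f} → (∀ x → + 0 ≤ f x) → ∑ n f ≡ + 0 → (i : Fin n) → f (+ toℕ i) ≡ + 0
  ∑-nonneg-zero {suc n} {f} f≥0 s = λ { Fin.zero → f₀≡0 ; (Fin.suc j) → ∑-nonneg-zero (λ x → f≥0 (+ 1 + x)) F≡0 j }
    where
    f₀ F : ℤ
    f₀ = f (+ 0)
    F = ∑ n (λ x → f (+ 1 + x))
    f₀≤f₀+F : f₀ ≤ f₀ + F
    f₀≤f₀+F = subst (_≤ f₀ + F) (ℤP.+-identityʳ f₀) (ℤP.+-monoʳ-≤ f₀ (∑-nonneg {n} (λ x → f≥0 (+ 1 + x))))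
    f₀≡0 : f₀ ≡ + 0
    f₀≡0 = ℤP.≤-antisym (subst (f₀ ≤_) s f₀≤f₀+F) (f≥0 (+ 0))
    F≡0 : F ≡ + 0
    F≡0 = trans (sym (ℤP.+-identityˡ F)) (trans (cong (_+ F) (sym f₀≡0)) s)

∑-*ʳ : ∀ {n} k f → ∑[ x < n ] (f x * k) ≡ ∑ n f * k
∑-*ʳ {n} k f = begin
  ∑[ x < n ] (f x * k) ≡⟨ ∑-cong (λ x → ℤP.*-comm (f x) k) ⟩
  ∑[ x < n ] (k * f x) ≡⟨ ∑-*ˡ k f ⟩
  k * ∑ n f           ≡⟨ ℤP.*-comm k _ ⟩
  ∑ n f * k           ∎

∑-neg : ∀ {n} f → ∑[ x < n ] (- f x) ≡ - ∑ n f
∑-neg {n} f = begin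
  ∑[ x < n ] (- f x)        ≡⟨ ∑-cong (λ x → sym (ℤP.-1*i≡-i (f x))) ⟩
  ∑[ x < n ] (- + 1 * f x)  ≡⟨ ∑-*ˡ (- + 1) f ⟩
  - + 1 * ∑ n f             ≡⟨ ℤP.-1*i≡-i _ ⟩
  - ∑ n f                   ∎

∑-distrib-minus : ∀ {n} f g → ∑[ x < n ] (f x - g x) ≡ ∑ n f - ∑ n g
∑-distrib-minus {n} f g = trans (∑-distrib-+ f (λ x → - g x)) (cong (ℤ._+_ (∑ n f)) (∑-neg g))

-- Congruences and reindexing of sums over residues

-- Divisibilities are proved by certificate throughout: the coefficients k and l are supplied, and
-- what remains is a polynomial identity.
∣-lin : ∀ {d u v z} k l → d ∣ u → d ∣ v → z ≡ k * u + l * v → d ∣ z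
∣-lin k l d∣u d∣v eq = subst (_ ∣_) (sym eq) (∣ℤ.∣m∣n⇒∣m+n (∣ℤ.∣n⇒∣m*n k d∣u) (∣ℤ.∣n⇒∣m*n l d∣v))

∣-mul : ∀ {d u z} k → d ∣ u → z ≡ k * u → d ∣ z
∣-mul k d∣u eq = subst (_ ∣_) (sym eq) (∣ℤ.∣n⇒∣m*n k d∣u)

opaque
  ind : ∀ {A : Set} → Dec A → ℤ
  ind (yes _) = + 1
  ind (no _)  = + 0

  ind-yes : ∀ {A : Set} (A? : Dec A) → A → ind A? ≡ + 1
  ind-yes (yes _) a = refl
  ind-yes (no ¬a) a = ⊥-elim (¬a a)

  ind-no : ∀ {A : Set} (A? : Dec A) → ¬ A → ind A? ≡ + 0
  ind-no (yes a) ¬a = ⊥-elim (¬a a)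
  ind-no (no _)  ¬a = refl

module Congruence (p : ℕ) where

  infix 4 _≈_

  record _≈_ (a b : ℤ) : Set where
    constructor mod
    field ≈⇒∣ : + p ∣ a - b
  open _≈_ public

  Per : (ℤ → ℤ) → Set
  Per f = ∀ {a b} → a ≈ b → f a ≡ f b

  ≈-reflexive : ∀ {a b} → a ≡ b → a ≈ b
  ≈-reflexive {a} refl = mod (divides (+ 0) (ℤP.+-inverseʳ a))

  ≈-refl : ∀ {a} → a ≈ a
  ≈-refl = ≈-reflexive refl

  ≈-sym : ∀ {a b} → a ≈ b → b ≈ a
  ≈-sym {a} {b} (mod d) = mod (∣-mul (- + 1) d (solve (a ∷ b ∷ [])))

  ≈-trans : ∀ {a b c} → a ≈ b → b ≈ c → a ≈ c
  ≈-trans {a} {b} {c} (mod d) (mod e) = mod (∣-lin (+ 1) (+ 1) d e (solve (a ∷ b ∷ c ∷ [])))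

  -‿≈ : ∀ {a b c d} → a ≈ b → c ≈ d → a - c ≈ b - d
  -‿≈ {a} {b} {c} {d} (mod u) (mod v) = mod (∣-lin (+ 1) (- + 1) u v (solve (a ∷ b ∷ c ∷ d ∷ [])))

  *-≈ : ∀ {a b c d} → a ≈ b → c ≈ d → a * c ≈ b * d
  *-≈ {a} {b} {c} {d} (mod u) (mod v) = mod (∣-lin c b u v (solve (a ∷ b ∷ c ∷ d ∷ [])))

  ≈-∣ : ∀ {a b} → a ≈ b → + p ∣ a → + p ∣ b
  ≈-∣ {a} {b} (mod u) d = ∣-lin (+ 1) (- + 1) d u (solve (a ∷ b ∷ []))

  opaque
    δ : ℤ → ℤ
    δ a = ind (+ p ∣? a)

    δ-yes : ∀ {a} → + p ∣ a → δ a ≡ + 1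
    δ-yes {a} = ind-yes (+ p ∣? a)

    δ-no : ∀ {a} → ¬ + p ∣ a → δ a ≡ + 0
    δ-no {a} = ind-no (+ p ∣? a)

  δ-nonzero : ∀ {a} → δ a ≢ + 0 → + p ∣ a
  δ-nonzero {a} δ≢0 = case + p ∣? a of λ where
    (yes d) → d
    (no ¬d) → ⊥-elim (δ≢0 (δ-no ¬d))

  δ-⇔ : ∀ {a b} → (+ p ∣ a → + p ∣ b) → (+ p ∣ b → + p ∣ a) → δ a ≡ δ b
  δ-⇔ {a} {b} f g = case + p ∣? b of λ where
    (yes d) → trans (δ-yes (g d)) (sym (δ-yes d))
    (no ¬d) → trans (δ-no (¬d ∘ f)) (sym (δ-no ¬d))

  δ-per : Per δ
  δ-per e = δ-⇔ (≈-∣ e) (≈-∣ (≈-sym e))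

  δ-swap : ∀ a b → δ (a - b) ≡ δ (b - a)
  δ-swap a b = δ-⇔ (λ d → ∣-mul (- + 1) d (solve (a ∷ b ∷ []))) (λ d → ∣-mul (- + 1) d (solve (a ∷ b ∷ [])))

  -- Next to a factor `δ a` the other factor may be rewritten as if p divided a. Constraints such as
  -- v² = u are used under a sum in this way.
  δ-on : ∀ {a x y} → (+ p ∣ a → x ≡ y) → δ a * x ≡ δ a * y
  δ-on {a} {x} {y} f = case + p ∣? a of λ where
    (yes d) → cong (ℤ._*_ (δ a)) (f d)
    (no ¬d) → trans (cong (_* x) (δ-no ¬d)) (sym (cong (_* y) (δ-no ¬d)))

  ∣-residue-unique : (i j : Fin p) → + p ∣ + toℕ i - + toℕ j → i ≡ j
  ∣-residue-unique i j d with ∣ + toℕ i - + toℕ j ∣ in eq | ∣⇒∣ᵤ d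
  ... | zero  | _ = FinP.toℕ-injective (ℤP.+-injective (ℤP.i-j≡0⇒i≡j _ _ (ℤP.∣i∣≡0⇒i≡0 eq)))
  ... | suc k | d′ = ⊥-elim (ℕD.>⇒∤ k<p d′)
    where
    k<p : suc k ℕ.< p
    k<p = ℕP.≤-<-trans
      (subst (ℕ._≤ toℕ i ℕ.⊔ toℕ j) (trans (cong ∣_∣ (sym (ℤP.m-n≡m⊖n (toℕ i) (toℕ j)))) eq) (ℤP.∣m⊝n∣≤m⊔n (toℕ i) (toℕ j)))
      (ℕP.⊔-lub (FinP.toℕ<n i) (FinP.toℕ<n j))

  module _ .{{_ : ℕ.NonZero p}} where

    residue : ∀ a → ∃ λ (r : Fin p) → a ≈ + toℕ r
    residue a = r , mod (divides q eq)
      where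
      r : Fin p
      r = fromℕ< (n%ℕd<d a p)
      q : ℤ
      q = a /ℕ p
      lemma : ∀ x y → (x + y) - x ≡ y
      lemma = solve-∀
      eq : a - + toℕ r ≡ q * + p
      eq = trans (cong₂ (λ u v → u - + v) (a≡a%ℕn+[a/ℕn]*n a p) (FinP.toℕ-fromℕ< (n%ℕd<d a p))) (lemma (+ (a %ℕ p)) (q * + p))

    ∑-sift : ∀ {f} a → Per f → ∑[ x < p ] (δ (x - a) * f x) ≡ f a
    ∑-sift {f} a per with residue a
    ... | r , a≈r = begin
      ∑[ x < p ] (δ (x - a) * f x)      ≡⟨ ∑-single r off ⟩
      δ (+ toℕ r - a) * f (+ toℕ r)      ≡⟨ cong₂ _*_ (δ-yes (≈⇒∣ (≈-sym a≈r))) (per (≈-sym a≈r)) ⟩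
      + 1 * f a                          ≡⟨ ℤP.*-identityˡ _ ⟩
      f a                                ∎
      where
      off : ∀ i → i ≢ r → δ (+ toℕ i - a) * f (+ toℕ i) ≡ + 0
      off i i≢r = cong (_* f (+ toℕ i)) (δ-no λ d → i≢r (∣-residue-unique i r (≈⇒∣ (≈-trans {+ toℕ i} {a} (mod d) a≈r))))

    ∑-δ : ∀ a → ∑[ x < p ] δ (x - a) ≡ + 1
    ∑-δ a = trans (∑-cong (λ x → sym (ℤP.*-identityʳ _))) (∑-sift {λ _ → + 1} a (λ _ → refl))

    -- The hypothesis says that φ and φ⁻¹ are mutually inverse modulo p.
    ∑-reindex : ∀ {f} (φ φ⁻¹ : ℤ → ℤ) → Per f → (∀ x y → δ (y - φ x) ≡ δ (x - φ⁻¹ y)) →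
                ∑[ x < p ] f (φ x) ≡ ∑ p f
    ∑-reindex {f} φ φ⁻¹ per inv = begin
      ∑[ x < p ] f (φ x)                              ≡⟨ ∑-cong (λ x → sym (∑-sift (φ x) per)) ⟩
      ∑[ x < p ] ∑[ y < p ] (δ (y - φ x) * f y)       ≡⟨ ∑-comm _ ⟩
      ∑[ y < p ] ∑[ x < p ] (δ (y - φ x) * f y)       ≡⟨ ∑-cong (λ y → ∑-cong (λ x → cong (_* f y) (inv x y))) ⟩
      ∑[ y < p ] ∑[ x < p ] (δ (x - φ⁻¹ y) * f y)     ≡⟨ ∑-cong (λ y → ∑-*ʳ (f y) _) ⟩
      ∑[ y < p ] ((∑[ x < p ] δ (x - φ⁻¹ y)) * f y)   ≡⟨ ∑-cong (λ y → cong (_* f y) (∑-δ (φ⁻¹ y))) ⟩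
      ∑[ y < p ] (+ 1 * f y)                          ≡⟨ ∑-cong (λ y → ℤP.*-identityˡ _) ⟩
      ∑ p f                                           ∎

    ∑-affine : ∀ {f a a⁻¹} b → a * a⁻¹ ≈ + 1 → Per f → ∑[ x < p ] f (a * x + b) ≡ ∑ p f
    ∑-affine {f} {a} {a⁻¹} b (mod u) per = ∑-reindex (λ x → a * x + b) (λ y → a⁻¹ * (y - b)) per λ x y →
      δ-⇔ (λ d → ∣-lin (- a⁻¹) (- x) d u (solve (a ∷ a⁻¹ ∷ b ∷ x ∷ y ∷ [])))
          (λ d → ∣-lin (- a) (- (y - b)) d u (solve (a ∷ a⁻¹ ∷ b ∷ x ∷ y ∷ [])))

    ∑-translate : ∀ {f} b → Per f → ∑[ x < p ] f (x + b) ≡ ∑ p f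
    ∑-translate {f} b per = trans (∑-cong (λ x → cong (λ z → f (z + b)) (sym (ℤP.*-identityˡ x)))) (∑-affine {a = + 1} {a⁻¹ = + 1} b ≈-refl per)

    ∑-reflect : ∀ {f} b → Per f → ∑[ x < p ] f (b - x) ≡ ∑ p f
    ∑-reflect {f} b per = trans (∑-cong (λ x → cong f (lemma b x))) (∑-affine {a = - + 1} {a⁻¹ = - + 1} b ≈-refl per)
      where
      lemma : ∀ b x → b - x ≡ - + 1 * x + b
      lemma = solve-∀

    ∑-scale : ∀ {f a a⁻¹} → a * a⁻¹ ≈ + 1 → Per f → ∑[ x < p ] f (a * x) ≡ ∑ p f
    ∑-scale {f} {a} {a⁻¹} u per = trans (∑-cong (λ x → cong f (sym (ℤP.+-identityʳ (a * x))))) (∑-affine {a = a} {a⁻¹ = a⁻¹} (+ 0) u per)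

-- Quadratic characters modulo a prime

i≡-i⇒i≡0 : ∀ {i} → i ≡ - i → i ≡ + 0
i≡-i⇒i≡0 {+ zero} e = refl

-- Bézout for the absolute value of a. Its two forms over ℕ and the two signs of a together decide
-- the sign of the inverse.
coprime⇒invertible : ∀ {n} a → Coprime ∣ a ∣ n → ∃ λ b → + n ∣ a * b - + 1
coprime⇒invertible {n} a co with ℤP.+∣i∣≡i⊎+∣i∣≡-i a | coprime-Bézout co
... | sgn | Bézout.+- x y eq = case sgn of λ where
    (inj₁ e) → + x , divides (+ y) (trans (cong (λ z → z * + x - + 1) (sym e)) (pos (+ ∣ a ∣) eqℤ))
    (inj₂ e) → - + x , divides (+ y) (trans (neg a (+ x)) (trans (cong (λ z → z * + x - + 1) (sym e)) (pos (+ ∣ a ∣) eqℤ)))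
  where
  eqℤ : + 1 + + y * + n ≡ + x * + ∣ a ∣
  eqℤ = trans (cong (λ z → + 1 + z) (sym (ℤP.pos-* y n))) (trans (cong +_ eq) (ℤP.pos-* x ∣ a ∣))
  neg : ∀ a x → a * - x - + 1 ≡ - a * x - + 1
  neg = solve-∀
  lemma : ∀ s t → (s + t) - s ≡ t
  lemma = solve-∀
  pos : ∀ m → + 1 + + y * + n ≡ + x * m → m * + x - + 1 ≡ + y * + n
  pos m e = trans (cong (_- + 1) (trans (ℤP.*-comm m (+ x)) (sym e))) (lemma (+ 1) (+ y * + n))
... | sgn | Bézout.-+ x y eq = case sgn of λ where
    (inj₁ e) → - + x , divides (- + y) (trans (cong (λ z → z * - + x - + 1) (sym e)) (pos (+ ∣ a ∣) eqℤ))
    (inj₂ e) → + x , divides (- + y) (trans (neg a (+ x)) (trans (cong (λ z → z * - + x - + 1) (sym e)) (pos (+ ∣ a ∣) eqℤ)))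
  where
  eqℤ : + 1 + + x * + ∣ a ∣ ≡ + y * + n
  eqℤ = trans (cong (λ z → + 1 + z) (sym (ℤP.pos-* x ∣ a ∣))) (trans (cong +_ eq) (ℤP.pos-* y n))
  neg : ∀ a x → a * x - + 1 ≡ - a * - x - + 1
  neg = solve-∀
  lemma : ∀ m x → m * - x - + 1 ≡ - (+ 1 + x * m)
  lemma = solve-∀
  pos : ∀ m → + 1 + + x * m ≡ + y * + n → m * - + x - + 1 ≡ - + y * + n
  pos m e = trans (lemma m (+ x)) (trans (cong -_ e) (ℤP.neg-distribˡ-* (+ y) (+ n)))

-- A common divisor d of m and p · p^k is coprime to p, since otherwise p would divide m; so d
-- already divides p^k.
prime-coprime-^ : ∀ {p m} k → Prime p → ¬ p ℕD.∣ m → Coprime m (p ℕ.^ k)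
prime-coprime-^ zero pr p∤m (d∣m , d∣1) = ℕD.∣1⇒≡1 d∣1
prime-coprime-^ {p} {m} (suc k) pr p∤m {d} (d∣m , d∣pp^k) =
  prime-coprime-^ k pr p∤m (d∣m , coprime-divisor coprime-d d∣pp^k)
  where
  coprime-d : Coprime d p
  coprime-d (e∣d , e∣p) = case prime⇒irreducible pr e∣p of λ where
    (inj₁ e≡1)  → e≡1
    (inj₂ refl) → ⊥-elim (p∤m (ℕD.∣-trans e∣d d∣m))

module PrimeModulus (p : ℕ) (pr : Prime p) where

  open Congruence p public

  private instance
    p≢0 : ℕ.NonZero p
    p≢0 = prime⇒nonZero pr

  euclid : ∀ a b → + p ∣ a * b → (+ p ∣ a) ⊎ (+ p ∣ b)
  euclid a b d = case euclidsLemma ∣ a ∣ ∣ b ∣ pr (subst (p ℕD.∣_) (ℤP.abs-* a b) (∣⇒∣ᵤ d)) of λ where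
    (inj₁ e) → inj₁ (∣ᵤ⇒∣ e)
    (inj₂ e) → inj₂ (∣ᵤ⇒∣ e)

  ∤-* : ∀ a b → ¬ + p ∣ a → ¬ + p ∣ b → ¬ + p ∣ a * b
  ∤-* a b p∤a p∤b d = [ p∤a , p∤b ]′ (euclid a b d)

  ∤1 : ¬ + p ∣ + 1
  ∤1 d = case subst Prime (ℕD.∣1⇒≡1 (∣⇒∣ᵤ d)) pr of λ ()

  inverse : ∀ {a} → ¬ + p ∣ a → ∃ λ b → a * b ≈ + 1
  inverse {a} p∤a with coprime⇒invertible a (subst (Coprime ∣ a ∣) (ℕP.*-identityʳ p) (prime-coprime-^ 1 pr (p∤a ∘ ∣ᵤ⇒∣)))
  ... | b , d = b , mod d

  δ-unit : ∀ {u} a → ¬ + p ∣ u → δ (u * a) ≡ δ a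
  δ-unit {u} a p∤u = δ-⇔ (λ d → [ ⊥-elim ∘ p∤u , (λ e → e) ]′ (euclid u a d)) (∣ℤ.∣n⇒∣m*n u)

  -- Integer-valued, so that the real parts of χ and of ψ² are both instances and can be compared by
  -- `quadratic-unique`.
  record QuadraticCharacter : Set where
    field
      η          : ℤ → ℤ
      η-per      : Per η
      η-*        : ∀ a b → η (a * b) ≡ η a * η b
      η-∣        : ∀ {a} → + p ∣ a → η a ≡ + 0
      η-unit     : ∀ {a} → ¬ + p ∣ a → η a ≡ + 1 ⊎ η a ≡ - + 1
      nonresidue : ∃ λ a → η a ≡ - + 1

    η² : ∀ a → η a * η a ≡ + 1 - δ a
    η² a = case + p ∣? a of λ where
      (yes d) → trans (cong (λ z → z * z) (η-∣ d)) (sym (cong (ℤ._-_ (+ 1)) (δ-yes d)))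
      (no ¬d) → trans ([ cong (λ z → z * z) , cong (λ z → z * z) ]′ (η-unit ¬d)) (sym (cong (ℤ._-_ (+ 1)) (δ-no ¬d)))

    η²-unit : ∀ {a} → ¬ + p ∣ a → η a * η a ≡ + 1
    η²-unit {a} p∤a = trans (η² a) (cong (ℤ._-_ (+ 1)) (δ-no p∤a))

    η1 : η (+ 1) ≡ + 1
    η1 = trans (η-* (+ 1) (+ 1)) (η²-unit ∤1)

    residue-∤ : ∀ {a} → η a ≡ + 1 → ¬ + p ∣ a
    residue-∤ ηa≡1 d = 1≢0 (trans (sym ηa≡1) (η-∣ d))
      where
      1≢0 : + 1 ≢ + 0
      1≢0 ()

    δη : ∀ a → δ a * η a ≡ + 0
    δη a = trans (δ-on (η-∣ {a})) (ℤP.*-zeroʳ (δ a))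

    -- Scaling the index by a nonresidue permutes the residues and changes the sign of the sum.
    ∑η : ∑ p η ≡ + 0
    ∑η with nonresidue
    ... | a , ηa≡-1 = i≡-i⇒i≡0 (sym neg)
      where
      p∤a : ¬ + p ∣ a
      p∤a d = case trans (sym (η-∣ d)) ηa≡-1 of λ ()
      neg : - ∑ p η ≡ ∑ p η
      neg = begin
        - ∑ p η                 ≡⟨ ℤP.-1*i≡-i _ ⟨
        - + 1 * ∑ p η           ≡⟨ cong (_* ∑ p η) ηa≡-1 ⟨
        η a * ∑ p η             ≡⟨ ∑-*ˡ (η a) η ⟨
        ∑[ x < p ] (η a * η x)  ≡⟨ ∑-cong (λ x → sym (η-* a x)) ⟩
        ∑[ x < p ] η (a * x)    ≡⟨ ∑-scale {a = a} {a⁻¹ = proj₁ (inverse p∤a)} (proj₂ (inverse p∤a)) η-per ⟩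
        ∑ p η                   ∎

  roots : ℤ → ℤ
  roots d = ∑[ x < p ] δ (x * x - d)

  roots-per : Per roots
  roots-per e = ∑-cong (λ x → δ-per (-‿≈ (≈-refl {x * x}) e))

  -- Each x is a square root of exactly one d.
  roots-total : ∑ p roots ≡ + p
  roots-total = begin
    ∑[ d < p ] ∑[ x < p ] δ (x * x - d)  ≡⟨ ∑-comm _ ⟩
    ∑[ x < p ] ∑[ d < p ] δ (x * x - d)  ≡⟨ ∑-cong (λ x → trans (∑-cong (δ-swap (x * x))) (∑-δ (x * x))) ⟩
    ∑[ x < p ] + 1                       ≡⟨ ∑-one ⟩
    + p                                  ∎

  roots-zero : ∀ {d} → + p ∣ d → roots d ≡ + 1
  roots-zero {d} p∣d = trans (∑-cong (λ x → δ-⇔ (to x) (from x))) (∑-δ (+ 0))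
    where
    to : ∀ x → + p ∣ x * x - d → + p ∣ x - + 0
    to x e = subst (+ p ∣_) (sym (ℤP.+-identityʳ x)) ([ (λ z → z) , (λ z → z) ]′ (euclid x x (∣-lin (+ 1) (+ 1) e p∣d (solve (x ∷ d ∷ [])))))
    from : ∀ x → + p ∣ x - + 0 → + p ∣ x * x - d
    from x e = ∣-lin x (- + 1) e p∣d (solve (x ∷ d ∷ []))

  square-unit : ∀ {d} y → ¬ + p ∣ d → + p ∣ y * y - d → ¬ + p ∣ y
  square-unit {d} y p∤d p∣y²-d e = p∤d (∣-lin y (- + 1) e p∣y²-d (solve (y ∷ d ∷ [])))

  module _ (p∤2 : ¬ + p ∣ + 2) where

    -- The roots are y and -y, which differ modulo p because p does not divide 2 y.
    roots-square : ∀ {d} y → ¬ + p ∣ d → + p ∣ y * y - d → roots d ≡ + 2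
    roots-square {d} y p∤d p∣y²-d = begin
      ∑[ x < p ] δ (x * x - d)                           ≡⟨ ∑-cong split ⟩
      ∑[ x < p ] (δ (x - y) + δ (x - - y))               ≡⟨ ∑-distrib-+ (λ x → δ (x - y)) (λ x → δ (x - - y)) ⟩
      (∑[ x < p ] δ (x - y)) + (∑[ x < p ] δ (x - - y))  ≡⟨ cong₂ _+_ (∑-δ y) (∑-δ (- y)) ⟩
      + 2                                                ∎
      where
      p∤y : ¬ + p ∣ y
      p∤y = square-unit y p∤d p∣y²-d
      diff : ∀ x → + p ∣ x - y → ¬ + p ∣ x - - y
      diff x e f = ∤-* (+ 2) y p∤2 p∤y (∣-lin (+ 1) (- + 1) f e (solve (x ∷ y ∷ [])))
      factor1 : ∀ x y d → x * x - d ≡ (x + y) * (x - y) + + 1 * (y * y - d)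
      factor1 = solve-∀
      factor2 : ∀ x y d → x * x - d ≡ (x - y) * (x - - y) + + 1 * (y * y - d)
      factor2 = solve-∀
      factor3 : ∀ x y d → (x - y) * (x - - y) ≡ + 1 * (x * x - d) + - + 1 * (y * y - d)
      factor3 = solve-∀
      split : ∀ x → δ (x * x - d) ≡ δ (x - y) + δ (x - - y)
      split x with + p ∣? x - y | + p ∣? x - - y
      ... | yes e | yes f = ⊥-elim (diff x e f)
      ... | yes e | no ¬f = trans (δ-yes (∣-lin (x + y) (+ 1) e p∣y²-d (factor1 x y d))) (sym (cong₂ _+_ (δ-yes e) (δ-no ¬f)))
      ... | no ¬e | yes f = trans (δ-yes (∣-lin (x - y) (+ 1) f p∣y²-d (factor2 x y d))) (sym (cong₂ _+_ (δ-no ¬e) (δ-yes f)))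
      ... | no ¬e | no ¬f = trans (δ-no λ g → ∤-* (x - y) (x - - y) ¬e ¬f (∣-lin (+ 1) (- + 1) g p∣y²-d (factor3 x y d))) (sym (cong₂ _+_ (δ-no ¬e) (δ-no ¬f)))

    module _ (C : QuadraticCharacter) where
      open QuadraticCharacter C

      η-≥-1 : ∀ a → + 0 ≤ + 1 + η a
      η-≥-1 a = case + p ∣? a of λ where
        (yes d) → subst (λ z → + 0 ≤ + 1 + z) (sym (η-∣ d)) (ℤ.+≤+ ℕ.z≤n)
        (no ¬d) → case η-unit ¬d of λ where
          (inj₁ e) → subst (λ z → + 0 ≤ + 1 + z) (sym e) (ℤ.+≤+ ℕ.z≤n)
          (inj₂ e) → subst (λ z → + 0 ≤ + 1 + z) (sym e) (ℤ.+≤+ ℕ.z≤n)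

      -- Three cases: d = 0 has one root and η d = 0; without roots 1 + η d is nonnegative anyway; a
      -- root y of a unit d forces η d = η(y)² = 1, and then both numbers are 2.
      roots-≤ : ∀ d → + 0 ≤ (+ 1 + η d) - roots d
      roots-≤ d with + p ∣? d
      ... | yes p∣d = ℤP.≤-reflexive (sym (cong₂ (λ u v → (+ 1 + u) - v) (η-∣ p∣d) (roots-zero p∣d)))
      ... | no p∤d with roots d ℤ.≟ + 0
      ...   | yes r≡0 = subst (λ z → + 0 ≤ (+ 1 + η d) - z) (sym r≡0) (subst (+ 0 ≤_) (sym (ℤP.+-identityʳ (+ 1 + η d))) (η-≥-1 d))
      ...   | no r≢0 with ∑-support r≢0
      ...     | i , δ≢0 = ℤP.≤-reflexive (sym (cong₂ (λ u v → (+ 1 + u) - v) ηd≡1 (roots-square y p∤d p∣y²-d)))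
        where
        y : ℤ
        y = + toℕ i
        p∣y²-d : + p ∣ y * y - d
        p∣y²-d = case + p ∣? (y * y - d) of λ where
          (yes e) → e
          (no ¬e) → ⊥-elim (δ≢0 (δ-no ¬e))
        p∤y : ¬ + p ∣ y
        p∤y = square-unit y p∤d p∣y²-d
        ηd≡1 : η d ≡ + 1
        ηd≡1 = trans (η-per (≈-sym {y * y} (mod p∣y²-d))) (trans (η-* y y) (η²-unit p∤y))

      -- Both sides have the same sum over the residues, and roots-≤ compares them termwise.
      roots≡1+η : ∀ d → roots d ≡ + 1 + η d
      roots≡1+η d with residue d
      ... | i , d≈i = begin
        roots d               ≡⟨ roots-per d≈i ⟩
        roots (+ toℕ i)       ≡⟨ ℤP.i-j≡0⇒i≡j _ _ (∑-nonneg-zero roots-≤ total i) ⟨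
        + 1 + η (+ toℕ i)     ≡⟨ cong (ℤ._+_ (+ 1)) (η-per d≈i) ⟨
        + 1 + η d             ∎
        where
        total : ∑[ d < p ] ((+ 1 + η d) - roots d) ≡ + 0
        total = begin
          ∑[ d < p ] ((+ 1 + η d) - roots d)        ≡⟨ ∑-distrib-minus (λ d → + 1 + η d) roots ⟩
          (∑[ d < p ] (+ 1 + η d)) - ∑ p roots      ≡⟨ cong₂ _-_ (∑-distrib-+ (λ _ → + 1) η) roots-total ⟩
          ((∑[ d < p ] + 1) + ∑ p η) - + p          ≡⟨ cong₂ (λ u v → (u + v) - + p) ∑-one ∑η ⟩
          (+ p + + 0) - + p                         ≡⟨ cong (_- + p) (ℤP.+-identityʳ (+ p)) ⟩
          + p - + p                                 ≡⟨ ℤP.+-inverseʳ (+ p) ⟩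
          + 0                                       ∎

      square-root : ∀ m → η m ≡ + 1 → ∃ λ (y : Fin p) → + p ∣ + toℕ y * + toℕ y - m
      square-root m ηm≡1 = proj₁ root , δ-nonzero (proj₂ root)
        where
        roots≡2 : roots m ≡ + 2
        roots≡2 = trans (roots≡1+η m) (cong (ℤ._+_ (+ 1)) ηm≡1)
        2≢0 : + 2 ≢ + 0
        2≢0 ()
        roots≢0 : roots m ≢ + 0
        roots≢0 e = 2≢0 (trans (sym roots≡2) e)
        root : ∃ λ (y : Fin p) → δ (+ toℕ y * + toℕ y - m) ≢ + 0
        root = ∑-support {p} {λ y → δ (y * y - m)} roots≢0

    -- Either value is `roots a` minus 1, and `roots` does not mention the character.
    quadratic-unique : ∀ C D a → QuadraticCharacter.η C a ≡ QuadraticCharacter.η D a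
    quadratic-unique C D a = ∙-cancelˡ ℤP.+-0-abelianGroup (+ 1) _ _ (trans (sym (roots≡1+η C a)) (roots≡1+η D a))

-- Evaluation of M

∑-distrib-+₆ : ∀ {n} f₁ f₂ f₃ f₄ f₅ f₆ → ∑[ x < n ] (f₁ x + f₂ x + f₃ x + f₄ x + f₅ x + f₆ x) ≡
  ∑ n f₁ + ∑ n f₂ + ∑ n f₃ + ∑ n f₄ + ∑ n f₅ + ∑ n f₆
∑-distrib-+₆ {n} f₁ f₂ f₃ f₄ f₅ f₆ =
  trans (∑-distrib-+ _ f₆) (cong (_+ ∑ n f₆)
  (trans (∑-distrib-+ _ f₅) (cong (_+ ∑ n f₅)
  (trans (∑-distrib-+ _ f₄) (cong (_+ ∑ n f₄)
  (trans (∑-distrib-+ _ f₃) (cong (_+ ∑ n f₃)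
  (∑-distrib-+ f₁ f₂))))))))

module QuadraticSums (p : ℕ) (pr : Prime p) (C : PrimeModulus.QuadraticCharacter p pr)
  (η-even : ∀ a → PrimeModulus.QuadraticCharacter.η C (- a) ≡ PrimeModulus.QuadraticCharacter.η C a) where

  open PrimeModulus p pr
  open QuadraticCharacter C

  private instance
    p≢0 : ℕ.NonZero p
    p≢0 = prime⇒nonZero pr

  η-swap : ∀ a b → η (a - b) ≡ η (b - a)
  η-swap a b = trans (cong η (flip a b)) (η-even (b - a))
    where
    flip : ∀ a b → a - b ≡ - (b - a)
    flip = solve-∀

  ∑-δ₀ : ∑ p δ ≡ + 1
  ∑-δ₀ = trans (∑-cong (λ x → cong δ (sym (ℤP.+-identityʳ x)))) (∑-δ (+ 0))

  ∑-δ₁ : ∑[ x < p ] δ (+ 1 - x) ≡ + 1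
  ∑-δ₁ = trans (∑-cong (δ-swap (+ 1))) (∑-δ (+ 1))

  ∑η₁ : ∑[ x < p ] η (+ 1 - x) ≡ + 0
  ∑η₁ = trans (∑-reflect (+ 1) η-per) ∑η

  ∑-η² : ∑[ x < p ] (η x * η x) ≡ + p - + 1
  ∑-η² = trans (∑-cong η²) (trans (∑-distrib-minus (λ _ → + 1) δ) (cong₂ _-_ ∑-one ∑-δ₀))

  private
    corr : ℤ → ℤ
    corr t = ∑[ s < p ] (η s * η (s - t))

    corr-zero : ∀ {t} → + p ∣ t → corr t ≡ + p - + 1
    corr-zero {t} p∣t = trans (∑-cong (λ s → cong (ℤ._*_ (η s)) (η-per {b = s} (mod (∣-mul (- + 1) p∣t (solve (s ∷ t ∷ []))))))) ∑-η²

    -- The substitution s to t s pulls out η(t)² = 1.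
    corr-unit : ∀ {t} → ¬ + p ∣ t → corr t ≡ corr (+ 1)
    corr-unit {t} p∤t = begin
      ∑[ s < p ] (η s * η (s - t))
        ≡⟨ ∑-scale {a = t} {a⁻¹ = proj₁ (inverse p∤t)} (proj₂ (inverse p∤t)) (λ e → cong₂ _*_ (η-per e) (η-per (-‿≈ e (≈-refl {t})))) ⟨
      ∑[ s < p ] (η (t * s) * η (t * s - t))  ≡⟨ ∑-cong scale ⟩
      ∑[ s < p ] (η s * η (s - + 1))          ∎
      where
      factor : ∀ t s → t * s - t ≡ t * (s - + 1)
      factor = solve-∀
      rearrange : ∀ a b c → (a * b) * (a * c) ≡ (a * a) * (b * c)
      rearrange = solve-∀
      scale : ∀ s → η (t * s) * η (t * s - t) ≡ η s * η (s - + 1)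
      scale s = begin
        η (t * s) * η (t * s - t)             ≡⟨ cong₂ _*_ (η-* t s) (trans (cong η (factor t s)) (η-* t (s - + 1))) ⟩
        (η t * η s) * (η t * η (s - + 1))     ≡⟨ rearrange (η t) (η s) _ ⟩
        (η t * η t) * (η s * η (s - + 1))     ≡⟨ cong (_* (η s * η (s - + 1))) (η²-unit p∤t) ⟩
        + 1 * (η s * η (s - + 1))             ≡⟨ ℤP.*-identityˡ _ ⟩
        η s * η (s - + 1)                     ∎

    corr-δ : ∀ t → corr t ≡ (+ p - + 1 - corr (+ 1)) * δ t + corr (+ 1)
    corr-δ t = case + p ∣? t of λ where
        (yes d) → trans (corr-zero d) (trans (lemma1 (+ p - + 1) (corr (+ 1))) (cong (λ z → (+ p - + 1 - corr (+ 1)) * z + corr (+ 1)) (sym (δ-yes d))))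
        (no ¬d) → trans (corr-unit ¬d) (trans (lemma0 (+ p - + 1) (corr (+ 1))) (cong (λ z → (+ p - + 1 - corr (+ 1)) * z + corr (+ 1)) (sym (δ-no ¬d))))
      where
      lemma1 : ∀ a c → a ≡ (a - c) * + 1 + c
      lemma1 = solve-∀
      lemma0 : ∀ a c → c ≡ (a - c) * + 0 + c
      lemma0 = solve-∀

    ∑-corr : ∑ p corr ≡ + 0
    ∑-corr = begin
      ∑[ t < p ] ∑[ s < p ] (η s * η (s - t))  ≡⟨ ∑-comm _ ⟩
      ∑[ s < p ] ∑[ t < p ] (η s * η (s - t))  ≡⟨ ∑-cong (λ s → trans (∑-*ˡ (η s) _) (cong (ℤ._*_ (η s)) (trans (∑-reflect s η-per) ∑η))) ⟩
      ∑[ s < p ] (η s * + 0)                   ≡⟨ ∑-cong (λ s → ℤP.*-zeroʳ (η s)) ⟩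
      ∑[ s < p ] + 0                           ≡⟨ ∑-zero ⟩
      + 0                                      ∎

    -- The autocorrelation is p - 1 at 0 and constant elsewhere, so its total is (p - 1)(c + 1) with
    -- c that constant. The total is 0, because summing over t first gives the sum of η.
    corr-one : corr (+ 1) ≡ - + 1
    corr-one = case ℤP.i*j≡0⇒i≡0∨j≡0 (+ p - + 1) (trans (sym total) ∑-corr) of λ where
        (inj₁ e) → ⊥-elim (p≢1 (ℤP.+-injective (ℤP.i-j≡0⇒i≡j (+ p) (+ 1) e)))
        (inj₂ e) → trans (lemma (corr (+ 1))) (cong (_- + 1) e)
      where
      p≢1 : p ≢ 1
      p≢1 e = case subst Prime e pr of λ ()
      lemma : ∀ c → c ≡ (c + + 1) - + 1
      lemma = solve-∀
      poly : ∀ P c → (P - + 1 - c) * + 1 + c * P ≡ (P - + 1) * (c + + 1)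
      poly = solve-∀
      total : ∑ p corr ≡ (+ p - + 1) * (corr (+ 1) + + 1)
      total = begin
        ∑ p corr ≡⟨ ∑-cong corr-δ ⟩
        ∑[ t < p ] ((+ p - + 1 - corr (+ 1)) * δ t + corr (+ 1))  ≡⟨ ∑-distrib-+ _ (λ _ → corr (+ 1)) ⟩
        (∑[ t < p ] ((+ p - + 1 - corr (+ 1)) * δ t)) + (∑[ _ < p ] corr (+ 1))
          ≡⟨ cong₂ _+_ (trans (∑-*ˡ (+ p - + 1 - corr (+ 1)) δ) (cong (ℤ._*_ (+ p - + 1 - corr (+ 1))) ∑-δ₀))
                       (trans (∑-cong (λ _ → sym (ℤP.*-identityʳ _))) (trans (∑-*ˡ (corr (+ 1)) (λ _ → + 1)) (cong (ℤ._*_ (corr (+ 1))) ∑-one))) ⟩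
        (+ p - + 1 - corr (+ 1)) * + 1 + corr (+ 1) * + p         ≡⟨ poly (+ p) (corr (+ 1)) ⟩
        (+ p - + 1) * (corr (+ 1) + + 1)                          ∎

  autocorrelation : ∀ t → ∑[ s < p ] (η s * η (s - t)) ≡ + p * δ t - + 1
  autocorrelation t = trans (corr-δ t) (trans (cong (λ c → (+ p - + 1 - c) * δ t + c) corr-one) (lemma (+ p) (δ t)))
    where
    lemma : ∀ P d → (P - + 1 - - + 1) * d + - + 1 ≡ P * d - + 1
    lemma = solve-∀

  -- `h` is four times the indicator that x and 1 - x are both nonzero squares; `k x` is η at x (1 -
  -- x).
  g h k : ℤ → ℤ
  g x = + 1 - δ x + η x
  h x = g x * g (+ 1 - x)
  k x = η x * η (+ 1 - x)

  g-per : Per g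
  g-per e = cong₂ (λ d c → + 1 - d + c) (δ-per e) (η-per e)

  -- `M` is 32 times the number of ordered pairs (s, t) that complete the edge 0, 1 to a 4-clique
  -- modulo p: five edges remain, each contributing a factor 2.
  X M : ℤ
  X = ∑[ s < p ] ∑[ t < p ] (k s * k t * η (s - t))
  M = ∑[ s < p ] ∑[ t < p ] (h s * h t * g (s - t))

  private
    1-≈ : ∀ {a b} → a ≈ b → + 1 - a ≈ + 1 - b
    1-≈ = -‿≈ (≈-refl {+ 1})

    δη₁ : ∀ x → δ x * η (+ 1 - x) ≡ δ x
    δη₁ x = trans (δ-on (λ d → trans (η-per {b = + 1} (mod (∣-mul (- + 1) d (solve (x ∷ []))))) η1)) (ℤP.*-identityʳ (δ x))

    δ₁η : ∀ x → δ (+ 1 - x) * η x ≡ δ (+ 1 - x)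
    δ₁η x = trans (δ-on (λ d → trans (η-per {b = + 1} (mod (∣-mul (- + 1) d (solve (x ∷ []))))) η1)) (ℤP.*-identityʳ (δ (+ 1 - x)))

    δδ₁ : ∀ x → δ x * δ (+ 1 - x) ≡ + 0
    δδ₁ x = trans (δ-on (λ d → δ-no (λ e → ∤1 (∣-lin (+ 1) (+ 1) d e (solve (x ∷ [])))))) (ℤP.*-zeroʳ (δ x))

    -- Where `g` is nonzero, η is 1 and δ is 0. Hence `g` and `h` absorb factors η and annihilate
    -- factors δ, which is what lets the expansion of M collapse to multiples of H and one unknown
    -- sum X.
    gη : ∀ x → g x * η x ≡ g x
    gη x = trans (lemma (δ x) (η x)) (trans (cong₂ (λ u v → η x - u + v) (δη x) (η² x)) (lemma′ (δ x) (η x)))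
      where
      lemma : ∀ d c → (+ 1 - d + c) * c ≡ c - d * c + c * c
      lemma = solve-∀
      lemma′ : ∀ d c → c - + 0 + (+ 1 - d) ≡ + 1 - d + c
      lemma′ = solve-∀

    gδ : ∀ x → g x * δ x ≡ + 0
    gδ x = trans (ℤP.*-comm (g x) (δ x)) (trans (δ-on (λ d → cong₂ (λ u v → + 1 - u + v) (δ-yes d) (η-∣ d))) (ℤP.*-zeroʳ (δ x)))

    g² : ∀ x → g x * g x ≡ + 2 * g x
    g² x = trans (lemma (g x) (δ x) (η x)) (trans (cong₂ (λ u v → g x - u + v) (gδ x) (gη x)) (lemma′ (g x)))
      where
      lemma : ∀ g d c → g * (+ 1 - d + c) ≡ g - g * d + g * c
      lemma = solve-∀
      lemma′ : ∀ g → g - + 0 + g ≡ + 2 * g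
      lemma′ = solve-∀

    hη : ∀ x → h x * η x ≡ h x
    hη x = trans (lemma (g x) (g (+ 1 - x)) (η x)) (cong (_* g (+ 1 - x)) (gη x))
      where
      lemma : ∀ a b c → a * b * c ≡ a * c * b
      lemma = solve-∀

    hη₁ : ∀ x → h x * η (+ 1 - x) ≡ h x
    hη₁ x = trans (ℤP.*-assoc (g x) _ _) (cong (ℤ._*_ (g x)) (gη (+ 1 - x)))

    hδ : ∀ x → h x * δ x ≡ + 0
    hδ x = trans (lemma (g x) (g (+ 1 - x)) (δ x)) (cong (_* g (+ 1 - x)) (gδ x))
      where
      lemma : ∀ a b c → a * b * c ≡ a * c * b
      lemma = solve-∀

    hδ₁ : ∀ x → h x * δ (+ 1 - x) ≡ + 0
    hδ₁ x = trans (ℤP.*-assoc (g x) _ _) (trans (cong (ℤ._*_ (g x)) (gδ (+ 1 - x))) (ℤP.*-zeroʳ (g x)))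

    h² : ∀ x → h x * h x ≡ + 4 * h x
    h² x = trans (lemma (g x) (g (+ 1 - x))) (trans (cong₂ _*_ (g² x) (g² (+ 1 - x))) (lemma′ (g x) (g (+ 1 - x))))
      where
      lemma : ∀ a b → (a * b) * (a * b) ≡ (a * a) * (b * b)
      lemma = solve-∀
      lemma′ : ∀ a b → (+ 2 * a) * (+ 2 * b) ≡ + 4 * (a * b)
      lemma′ = solve-∀

    h-per : Per h
    h-per e = cong₂ _*_ (g-per e) (g-per (1-≈ e))

    kδ : ∀ x → k x * δ x ≡ + 0
    kδ x = trans (lemma (η x) (η (+ 1 - x)) (δ x)) (cong (_* η (+ 1 - x)) (δη x))
      where
      lemma : ∀ a b c → a * b * c ≡ c * a * b
      lemma = solve-∀

    kδ₁ : ∀ x → k x * δ (+ 1 - x) ≡ + 0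
    kδ₁ x = trans (lemma (η x) (η (+ 1 - x)) (δ (+ 1 - x))) (cong (_* η x) (δη (+ 1 - x)))
      where
      lemma : ∀ a b c → a * b * c ≡ c * b * a
      lemma = solve-∀

    ∑k : ∑ p k ≡ - + 1
    ∑k = trans (∑-cong (λ x → cong (ℤ._*_ (η x)) (η-swap (+ 1) x))) corr-one

    ∑kη : ∑[ x < p ] (k x * η x) ≡ - + 1
    ∑kη = begin
      ∑[ x < p ] (k x * η x)               ≡⟨ ∑-cong pointwise ⟩
      ∑[ x < p ] (η (+ 1 - x) - δ x)       ≡⟨ ∑-distrib-minus (λ x → η (+ 1 - x)) δ ⟩
      (∑[ x < p ] η (+ 1 - x)) - ∑ p δ     ≡⟨ cong₂ _-_ ∑η₁ ∑-δ₀ ⟩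
      - + 1                                ∎
      where
      lemma : ∀ a b → a * b * a ≡ (a * a) * b
      lemma = solve-∀
      lemma′ : ∀ d b → (+ 1 - d) * b ≡ b - d * b
      lemma′ = solve-∀
      pointwise : ∀ x → k x * η x ≡ η (+ 1 - x) - δ x
      pointwise x = trans (lemma (η x) (η (+ 1 - x))) (trans (cong (_* η (+ 1 - x)) (η² x))
        (trans (lemma′ (δ x) (η (+ 1 - x))) (cong (ℤ._-_ (η (+ 1 - x))) (δη₁ x))))

    ∑kη₁ : ∑[ x < p ] (k x * η (+ 1 - x)) ≡ - + 1
    ∑kη₁ = begin
      ∑[ x < p ] (k x * η (+ 1 - x))             ≡⟨ ∑-cong pointwise ⟩
      ∑[ x < p ] (η x - δ (+ 1 - x))             ≡⟨ ∑-distrib-minus η (λ x → δ (+ 1 - x)) ⟩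
      ∑ p η - (∑[ x < p ] δ (+ 1 - x))           ≡⟨ cong₂ _-_ ∑η ∑-δ₁ ⟩
      - + 1                                      ∎
      where
      lemma : ∀ a b → a * b * b ≡ (b * b) * a
      lemma = solve-∀
      lemma′ : ∀ d b → (+ 1 - d) * b ≡ b - d * b
      lemma′ = solve-∀
      pointwise : ∀ x → k x * η (+ 1 - x) ≡ η x - δ (+ 1 - x)
      pointwise x = trans (lemma (η x) (η (+ 1 - x))) (trans (cong (_* η x) (η² (+ 1 - x)))
        (trans (lemma′ (δ (+ 1 - x)) (η x)) (cong (ℤ._-_ (η x)) (δ₁η x))))

    -- Each δ gets the coefficient -2: once from the 1 of the other factor of `h`, and once from its
    -- η, which is 1 at the zero in question. The two δ never meet, as 0 and 1 differ modulo p.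
    h-expand : ∀ x → h x ≡ + 1 + η x + η (+ 1 - x) + k x + - + 2 * δ x + - + 2 * δ (+ 1 - x)
    h-expand x = trans (lemma (δ x) (η x) (δ (+ 1 - x)) (η (+ 1 - x)))
      (trans (cong₂ (λ u v → e + u + (δ x - v) + (δ (+ 1 - x) - δ (+ 1 - x) * η x)) (δδ₁ x) (δη₁ x))
      (trans (cong (λ u → e + + 0 + (δ x - δ x) + (δ (+ 1 - x) - u)) (δ₁η x)) (lemma′ e (δ x) (δ (+ 1 - x)))))
      where
      e : ℤ
      e = + 1 + η x + η (+ 1 - x) + k x + - + 2 * δ x + - + 2 * δ (+ 1 - x)
      lemma : ∀ d c d′ c′ → (+ 1 - d + c) * (+ 1 - d′ + c′) ≡
        (+ 1 + c + c′ + c * c′ + - + 2 * d + - + 2 * d′) + d * d′ + (d - d * c′) + (d′ - d′ * c)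
      lemma = solve-∀
      lemma′ : ∀ e a b → e + + 0 + (a - a) + (b - b) ≡ e
      lemma′ = solve-∀

    H : ℤ
    H = ∑ p h

    -- Four times the classical number (p - 5)/4 of pairs of consecutive nonzero squares.
    H≡p-5 : H ≡ + p - + 5
    H≡p-5 = begin
      ∑ p h
        ≡⟨ trans (∑-cong h-expand) (∑-distrib-+₆ (λ _ → + 1) η (λ x → η (+ 1 - x)) k (λ x → - + 2 * δ x) (λ x → - + 2 * δ (+ 1 - x))) ⟩
      (∑[ _ < p ] + 1) + ∑ p η + (∑[ x < p ] η (+ 1 - x)) + ∑ p k + (∑[ x < p ] (- + 2 * δ x)) + (∑[ x < p ] (- + 2 * δ (+ 1 - x)))
        ≡⟨ cong₂ _+_ (cong₂ _+_ (cong₂ _+_ (cong₂ _+_ (cong₂ _+_ ∑-one ∑η) ∑η₁) ∑k)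
             (trans (∑-*ˡ (- + 2) δ) (cong (ℤ._*_ (- + 2)) ∑-δ₀))) (trans (∑-*ˡ (- + 2) _) (cong (ℤ._*_ (- + 2)) ∑-δ₁)) ⟩
      + p + + 0 + + 0 + - + 1 + - + 2 * + 1 + - + 2 * + 1  ≡⟨ lemma (+ p) ⟩
      + p - + 5                                            ∎
      where
      lemma : ∀ P → P + + 0 + + 0 + - + 1 + - + 2 * + 1 + - + 2 * + 1 ≡ P - + 5
      lemma = solve-∀

    K : ℤ → ℤ
    K t = ∑[ s < p ] (η (s - t) * k s)

    corr₁ : ∀ t → ∑[ s < p ] (η (s - t) * η (+ 1 - s)) ≡ + p * δ (+ 1 - t) - + 1
    corr₁ t = begin
      ∑[ s < p ] (η (s - t) * η (+ 1 - s))
        ≡⟨ ∑-reflect (+ 1) (λ e → cong₂ _*_ (η-per (-‿≈ e (≈-refl {t}))) (η-per (1-≈ e))) ⟨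
      ∑[ s < p ] (η (+ 1 - s - t) * η (+ 1 - (+ 1 - s)))
        ≡⟨ ∑-cong (λ s → trans (cong₂ (λ u v → η u * η v) (lemma s t) (lemma′ s)) (trans (ℤP.*-comm _ (η s)) (cong (ℤ._*_ (η s)) (η-swap (+ 1 - t) s)))) ⟩
      ∑[ s < p ] (η s * η (s - (+ 1 - t)))  ≡⟨ autocorrelation (+ 1 - t) ⟩
      + p * δ (+ 1 - t) - + 1               ∎
      where
      lemma : ∀ s t → + 1 - s - t ≡ + 1 - t - s
      lemma = solve-∀
      lemma′ : ∀ s → + 1 - (+ 1 - s) ≡ s
      lemma′ = solve-∀

    -- Convolve η with the six terms of `h-expand`: the constant gives 0, the two η terms give
    -- autocorrelations at shifts t and 1 - t, `k` gives `K t` by definition, and the two δ terms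
    -- sift out values of η.
    convolve-h : ∀ t → ∑[ s < p ] (η (s - t) * h s) ≡
      (+ p * δ t - + 1) + (+ p * δ (+ 1 - t) - + 1) + K t + - + 2 * η t + - + 2 * η (+ 1 - t)
    convolve-h t = begin
      ∑[ s < p ] (η (s - t) * h s)
        ≡⟨ ∑-cong (λ s → trans (cong (ℤ._*_ (η (s - t))) (h-expand s)) (expand (η (s - t)) (η s) (η (+ 1 - s)) (k s) (δ s) (δ (+ 1 - s)))) ⟩
      ∑[ s < p ] (η (s - t) + η s * η (s - t) + η (s - t) * η (+ 1 - s) + η (s - t) * k s + - + 2 * (δ s * η (s - t)) + - + 2 * (δ (+ 1 - s) * η (s - t)))
        ≡⟨ ∑-distrib-+₆ (λ s → η (s - t)) (λ s → η s * η (s - t)) (λ s → η (s - t) * η (+ 1 - s)) (λ s → η (s - t) * k s)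
             (λ s → - + 2 * (δ s * η (s - t))) (λ s → - + 2 * (δ (+ 1 - s) * η (s - t))) ⟩
      _ ≡⟨ cong₂ _+_ (cong₂ _+_ (cong₂ _+_ (cong₂ _+_ (cong₂ _+_ (trans (∑-translate (- t) η-per) ∑η) (autocorrelation t)) (corr₁ t)) refl)
             (trans (∑-*ˡ (- + 2) _) (cong (ℤ._*_ (- + 2)) sift₀))) (trans (∑-*ˡ (- + 2) _) (cong (ℤ._*_ (- + 2)) sift₁)) ⟩
      + 0 + (+ p * δ t - + 1) + (+ p * δ (+ 1 - t) - + 1) + K t + - + 2 * η t + - + 2 * η (+ 1 - t)
        ≡⟨ cong (λ z → z + (+ p * δ (+ 1 - t) - + 1) + K t + - + 2 * η t + - + 2 * η (+ 1 - t)) (ℤP.+-identityˡ (+ p * δ t - + 1)) ⟩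
      (+ p * δ t - + 1) + (+ p * δ (+ 1 - t) - + 1) + K t + - + 2 * η t + - + 2 * η (+ 1 - t) ∎
      where
      expand : ∀ c a b k d d′ → c * (+ 1 + a + b + k + - + 2 * d + - + 2 * d′) ≡
        c + a * c + c * b + c * k + - + 2 * (d * c) + - + 2 * (d′ * c)
      expand = solve-∀
      -t-per : Per (λ s → η (s - t))
      -t-per e = η-per (-‿≈ e (≈-refl {t}))
      sift₀ : ∑[ s < p ] (δ s * η (s - t)) ≡ η t
      sift₀ = trans (∑-cong (λ s → cong (λ z → δ z * η (s - t)) (sym (ℤP.+-identityʳ s))))
        (trans (∑-sift (+ 0) -t-per) (trans (η-swap (+ 0) t) (cong η (ℤP.+-identityʳ t))))
      sift₁ : ∑[ s < p ] (δ (+ 1 - s) * η (s - t)) ≡ η (+ 1 - t)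
      sift₁ = trans (∑-cong (λ s → cong (_* η (s - t)) (δ-swap (+ 1) s))) (∑-sift (+ 1) -t-per)

    -- `k` vanishes at 0 and 1, which removes the terms with p. The 6 is three times (-2)(-1): from
    -- η t, from η (1 - t), and from the two constants -1 taken together.
    ∑kG : ∑[ t < p ] (k t * (∑[ s < p ] (η (s - t) * h s))) ≡ X + + 6
    ∑kG = begin
      ∑[ t < p ] (k t * (∑[ s < p ] (η (s - t) * h s)))
        ≡⟨ ∑-cong (λ t → trans (cong (ℤ._*_ (k t)) (convolve-h t)) (trans (expand (k t) (+ p) (δ t) (δ (+ 1 - t)) (K t) (η t) (η (+ 1 - t)))
             (cong₂ (λ u v → + p * u + + p * v + k t * K t + - + 2 * (k t * η t) + - + 2 * (k t * η (+ 1 - t)) + - + 2 * k t) (kδ t) (kδ₁ t)))) ⟩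
      ∑[ t < p ] (+ p * + 0 + + p * + 0 + k t * K t + - + 2 * (k t * η t) + - + 2 * (k t * η (+ 1 - t)) + - + 2 * k t)
        ≡⟨ ∑-distrib-+₆ (λ _ → + p * + 0) (λ _ → + p * + 0) (λ t → k t * K t) (λ t → - + 2 * (k t * η t)) (λ t → - + 2 * (k t * η (+ 1 - t))) (λ t → - + 2 * k t) ⟩
      _ ≡⟨ cong₂ _+_ (cong₂ _+_ (cong₂ _+_ (cong₂ _+_ (cong₂ _+_ zero′ zero′) ∑kK) (trans (∑-*ˡ (- + 2) _) (cong (ℤ._*_ (- + 2)) ∑kη)))
             (trans (∑-*ˡ (- + 2) _) (cong (ℤ._*_ (- + 2)) ∑kη₁))) (trans (∑-*ˡ (- + 2) k) (cong (ℤ._*_ (- + 2)) ∑k)) ⟩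
      + 0 + + 0 + X + - + 2 * - + 1 + - + 2 * - + 1 + - + 2 * - + 1 ≡⟨ lemma X ⟩
      X + + 6 ∎
      where
      expand : ∀ k P d d′ K c c′ → k * ((P * d - + 1) + (P * d′ - + 1) + K + - + 2 * c + - + 2 * c′) ≡
        P * (k * d) + P * (k * d′) + k * K + - + 2 * (k * c) + - + 2 * (k * c′) + - + 2 * k
      expand = solve-∀
      lemma : ∀ X → + 0 + + 0 + X + - + 2 * - + 1 + - + 2 * - + 1 + - + 2 * - + 1 ≡ X + + 6
      lemma = solve-∀
      rearrange : ∀ a b c → a * (c * b) ≡ b * a * c
      rearrange = solve-∀
      zero′ : ∑[ _ < p ] (+ p * + 0) ≡ + 0
      zero′ = trans (∑-cong (λ _ → ℤP.*-zeroʳ (+ p))) ∑-zero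
      ∑kK : ∑[ t < p ] (k t * K t) ≡ X
      ∑kK = begin
        ∑[ t < p ] (k t * K t)                           ≡⟨ ∑-cong (λ t → sym (∑-*ˡ (k t) _)) ⟩
        ∑[ t < p ] ∑[ s < p ] (k t * (η (s - t) * k s))  ≡⟨ ∑-comm _ ⟩
        ∑[ s < p ] ∑[ t < p ] (k t * (η (s - t) * k s))  ≡⟨ ∑-cong (λ s → ∑-cong (λ t → rearrange (k t) (k s) (η (s - t)))) ⟩
        X                                                ∎

    -- Convolution with the even function η is self-adjoint, so `h` and `k` trade places and `∑kG`
    -- applies.
    ∑hK : ∑[ t < p ] (h t * K t) ≡ X + + 6
    ∑hK = begin
      ∑[ t < p ] (h t * K t)                            ≡⟨ ∑-cong (λ t → sym (∑-*ˡ (h t) _)) ⟩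
      ∑[ t < p ] ∑[ s < p ] (h t * (η (s - t) * k s))   ≡⟨ ∑-comm _ ⟩
      ∑[ s < p ] ∑[ t < p ] (h t * (η (s - t) * k s))
        ≡⟨ ∑-cong (λ s → trans (∑-cong (λ t → trans (rearrange (h t) (η (s - t)) (k s)) (cong (λ z → k s * (z * h t)) (η-swap s t)))) (∑-*ˡ (k s) _)) ⟩
      ∑[ s < p ] (k s * (∑[ t < p ] (η (t - s) * h t))) ≡⟨ ∑kG ⟩
      X + + 6                                           ∎
      where
      rearrange : ∀ a c b → a * (c * b) ≡ b * (c * a)
      rearrange = solve-∀

    -- Paired with `h`, both δ terms vanish and both η terms become `h`; with the two constants -1
    -- this makes -2 - 2 - 2 = -6 copies of `h`.
    Z≡ : ∑[ t < p ] (h t * (∑[ s < p ] (η (s - t) * h s))) ≡ X + + 6 - + 6 * H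
    Z≡ = begin
      ∑[ t < p ] (h t * (∑[ s < p ] (η (s - t) * h s)))
        ≡⟨ ∑-cong (λ t → trans (cong (ℤ._*_ (h t)) (convolve-h t)) (trans (expand (h t) (+ p) (δ t) (δ (+ 1 - t)) (K t) (η t) (η (+ 1 - t)))
             (trans (cong₂ (λ u v → + p * u + + p * v + h t * K t + - + 2 * (h t * η t) + - + 2 * (h t * η (+ 1 - t)) + - + 2 * h t) (hδ t) (hδ₁ t))
             (trans (cong₂ (λ u v → + p * + 0 + + p * + 0 + h t * K t + - + 2 * u + - + 2 * v + - + 2 * h t) (hη t) (hη₁ t))
               (collect (+ p) (h t) (h t * K t)))))) ⟩
      ∑[ t < p ] (h t * K t - + 6 * h t)        ≡⟨ ∑-distrib-minus (λ t → h t * K t) (λ t → + 6 * h t) ⟩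
      (∑[ t < p ] (h t * K t)) - (∑[ t < p ] (+ 6 * h t)) ≡⟨ cong₂ _-_ ∑hK (∑-*ˡ (+ 6) h) ⟩
      X + + 6 - + 6 * H                         ∎
      where
      expand : ∀ k P d d′ K c c′ → k * ((P * d - + 1) + (P * d′ - + 1) + K + - + 2 * c + - + 2 * c′) ≡
        P * (k * d) + P * (k * d′) + k * K + - + 2 * (k * c) + - + 2 * (k * c′) + - + 2 * k
      expand = solve-∀
      collect : ∀ P h K → P * + 0 + P * + 0 + K + - + 2 * h + - + 2 * h + - + 2 * h ≡ K - + 6 * h
      collect = solve-∀

  -- Splitting g (s - t) into 1, -δ and η gives H², the diagonal -∑h² = -4H, and the sum in `Z≡`.
  -- With H = p - 5 the part without X is H² - 10 H + 6 = (p - 9)² - 2p.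
  M≡ : M ≡ (+ p - + 9) * (+ p - + 9) - + 2 * + p + X
  M≡ = begin
    ∑[ s < p ] ∑[ t < p ] (h s * h t * g (s - t))  ≡⟨ ∑-comm _ ⟩
    ∑[ t < p ] ∑[ s < p ] (h s * h t * g (s - t))  ≡⟨ ∑-cong inner ⟩
    ∑[ t < p ] (H * h t - h t * h t + h t * (∑[ s < p ] (η (s - t) * h s)))
      ≡⟨ ∑-distrib-+ (λ t → H * h t - h t * h t) _ ⟩
    (∑[ t < p ] (H * h t - h t * h t)) + (∑[ t < p ] (h t * (∑[ s < p ] (η (s - t) * h s))))
      ≡⟨ cong₂ _+_ (trans (∑-distrib-minus (λ t → H * h t) (λ t → h t * h t)) (cong₂ _-_ (∑-*ˡ H h) (trans (∑-cong h²) (∑-*ˡ (+ 4) h)))) Z≡ ⟩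
    (H * H - + 4 * H) + (X + + 6 - + 6 * H)        ≡⟨ cong (λ H → (H * H - + 4 * H) + (X + + 6 - + 6 * H)) H≡p-5 ⟩
    _                                              ≡⟨ lemma (+ p) X ⟩
    (+ p - + 9) * (+ p - + 9) - + 2 * + p + X      ∎
    where
    lemma : ∀ P X → ((P - + 5) * (P - + 5) - + 4 * (P - + 5)) + (X + + 6 - + 6 * (P - + 5)) ≡ (P - + 9) * (P - + 9) - + 2 * P + X
    lemma = solve-∀
    expand : ∀ a b d c → a * b * (+ 1 - d + c) ≡ (b * a - b * (d * a)) + b * (c * a)
    expand = solve-∀
    inner : ∀ t → ∑[ s < p ] (h s * h t * g (s - t)) ≡ H * h t - h t * h t + h t * (∑[ s < p ] (η (s - t) * h s))
    inner t = begin
      ∑[ s < p ] (h s * h t * g (s - t))  ≡⟨ ∑-cong (λ s → expand (h s) (h t) (δ (s - t)) (η (s - t))) ⟩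
      ∑[ s < p ] ((h t * h s - h t * (δ (s - t) * h s)) + h t * (η (s - t) * h s))
        ≡⟨ trans (∑-distrib-+ (λ s → h t * h s - h t * (δ (s - t) * h s)) (λ s → h t * (η (s - t) * h s)))
             (cong (_+ (∑[ s < p ] (h t * (η (s - t) * h s)))) (∑-distrib-minus (λ s → h t * h s) (λ s → h t * (δ (s - t) * h s)))) ⟩
      (∑[ s < p ] (h t * h s)) - (∑[ s < p ] (h t * (δ (s - t) * h s))) + (∑[ s < p ] (h t * (η (s - t) * h s)))
        ≡⟨ cong₂ _+_ (cong₂ _-_ (trans (∑-*ˡ (h t) h) (ℤP.*-comm (h t) H)) (trans (∑-*ˡ (h t) _) (cong (ℤ._*_ (h t)) (∑-sift t h-per)))) (∑-*ˡ (h t) _) ⟩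
      H * h t - h t * h t + h t * (∑[ s < p ] (η (s - t) * h s)) ∎

-- The square of the Jacobi sum

module JacobiSquare (p : ℕ) (pr : Prime p) (C : PrimeModulus.QuadraticCharacter p pr)
  (η-even : ∀ a → PrimeModulus.QuadraticCharacter.η C (- a) ≡ PrimeModulus.QuadraticCharacter.η C a)
  (p∤2 : ¬ + p ∣ + 2) where

  open PrimeModulus p pr
  open QuadraticCharacter C
  open QuadraticSums p pr C η-even

  private instance
    p≢0 : ℕ.NonZero p
    p≢0 = prime⇒nonZero pr

  private
    p∤4 : ¬ + p ∣ - + 4
    p∤4 = ∤-* (+ 2) (- + 2) p∤2 (λ d → p∤2 (∣-mul (- + 1) d refl))

    ∑-δ-linear : ∀ v {z} → ¬ + p ∣ z → ∑[ y < p ] δ (z * y - v) ≡ + 1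
    ∑-δ-linear v {z} p∤z = begin
      ∑[ y < p ] δ (z * y - v)  ≡⟨ ∑-scale {a = z} {a⁻¹ = proj₁ (inverse p∤z)} (proj₂ (inverse p∤z)) (λ e → δ-per (-‿≈ e (≈-refl {v}))) ⟩
      ∑[ y < p ] δ (y - v)      ≡⟨ ∑-δ v ⟩
      + 1                       ∎

    -- The constraint z y = v gives z (1 - y) = z - v, so η (1 - y) = η z η (z - v) for its unique
    -- solution y. If p divides z there is no solution, and the right side is 0 too.
    y-sum : ∀ {v} z → ¬ + p ∣ v → ∑[ y < p ] (δ (z * y - v) * η (+ 1 - y)) ≡ η z * η (z - v)
    y-sum {v} z p∤v = case + p ∣? z of λ where
        (yes p∣z) → trans (∑-cong (λ y → cong (_* η (+ 1 - y)) (δ-no (λ d → p∤v (∣-lin y (- + 1) p∣z d (lemma y z v))))))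
                          (trans ∑-zero (sym (cong (_* η (z - v)) (η-∣ p∣z))))
        (no p∤z) → begin
          ∑[ y < p ] (δ (z * y - v) * η (+ 1 - y))          ≡⟨ ∑-cong (λ y → δ-on (on p∤z y)) ⟩
          ∑[ y < p ] (δ (z * y - v) * (η z * η (z - v)))    ≡⟨ ∑-*ʳ (η z * η (z - v)) (λ y → δ (z * y - v)) ⟩
          (∑[ y < p ] δ (z * y - v)) * (η z * η (z - v))    ≡⟨ cong (_* (η z * η (z - v))) (∑-δ-linear v p∤z) ⟩
          + 1 * (η z * η (z - v))                           ≡⟨ ℤP.*-identityˡ _ ⟩
          η z * η (z - v)                                   ∎
      where
      lemma : ∀ y z v → v ≡ y * z + - + 1 * (z * y - v)
      lemma = solve-∀
      close : ∀ y z v → z * (+ 1 - y) - (z - v) ≡ - + 1 * (z * y - v)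
      close = solve-∀
      on : ¬ + p ∣ z → ∀ y → + p ∣ z * y - v → η (+ 1 - y) ≡ η z * η (z - v)
      on p∤z y d = begin
        η (+ 1 - y)                  ≡⟨ ℤP.*-identityˡ _ ⟨
        + 1 * η (+ 1 - y)            ≡⟨ cong (_* η (+ 1 - y)) (η²-unit p∤z) ⟨
        η z * η z * η (+ 1 - y)      ≡⟨ ℤP.*-assoc (η z) (η z) _ ⟩
        η z * (η z * η (+ 1 - y))    ≡⟨ cong (ℤ._*_ (η z)) (η-* z (+ 1 - y)) ⟨
        η z * η (z * (+ 1 - y))      ≡⟨ cong (ℤ._*_ (η z)) (η-per (mod (∣-mul (- + 1) d (close y z v)))) ⟩
        η z * η (z - v)              ∎

    Y-term : ℤ → ℤ → ℤ
    Y-term v z = η v * η z * (η (+ 1 - v * z) * η (z - v))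

    -- For a unit v the substitution x = v z turns v² = x y into v = z y, which `y-sum` solves for
    -- y. If p divides v, both sides vanish through the factor η v.
    xy-sum : ∀ v → ∑[ x < p ] ∑[ y < p ] (δ (v * v - x * y) * η v * (η (+ 1 - x) * η (+ 1 - y))) ≡ ∑[ z < p ] Y-term v z
    xy-sum v = case + p ∣? v of λ where
        (yes p∣v) → trans
          (∑-cong (λ x → trans (∑-cong (λ y → cong (_* (η (+ 1 - x) * η (+ 1 - y))) (trans (cong (ℤ._*_ (δ (v * v - x * y))) (η-∣ p∣v)) (ℤP.*-zeroʳ (δ (v * v - x * y)))))) ∑-zero))
          (sym (∑-cong (λ z → cong (λ c → c * η z * (η (+ 1 - v * z) * η (z - v))) (η-∣ p∣v))))
        (no p∤v) → begin
          ∑ p F ≡⟨ ∑-scale {a = v} {a⁻¹ = proj₁ (inverse p∤v)} (proj₂ (inverse p∤v)) F-per ⟨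
          ∑[ z < p ] F (v * z) ≡⟨ ∑-cong (λ z → trans (∑-cong (λ y → trans
             (cong (λ d → d * η v * (η (+ 1 - v * z) * η (+ 1 - y))) (δ-vz p∤v z y)) (rearrange (δ (z * y - v)) (η v) _ _)))
             (trans (∑-*ˡ (η v * η (+ 1 - v * z)) (λ y → δ (z * y - v) * η (+ 1 - y))) (trans (cong (ℤ._*_ (η v * η (+ 1 - v * z))) (y-sum z p∤v))
               (rearrange′ (η v) (η (+ 1 - v * z)) (η z) _)))) ⟩
          ∑[ z < p ] Y-term v z ∎
      where
      F : ℤ → ℤ
      F x = ∑[ y < p ] (δ (v * v - x * y) * η v * (η (+ 1 - x) * η (+ 1 - y)))
      F-per : Per F
      F-per e = ∑-cong (λ y → cong₂ (λ d c → d * η v * (c * η (+ 1 - y)))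
        (δ-per (-‿≈ (≈-refl {v * v}) (*-≈ e (≈-refl {y})))) (η-per (-‿≈ (≈-refl {+ 1}) e)))
      rearrange : ∀ d v a b → d * v * (a * b) ≡ (v * a) * (d * b)
      rearrange = solve-∀
      rearrange′ : ∀ v a z b → (v * a) * (z * b) ≡ v * z * (a * b)
      rearrange′ = solve-∀
      factor : ∀ v z y → v * v - v * z * y ≡ v * (v - z * y)
      factor = solve-∀
      δ-vz : ¬ + p ∣ v → ∀ z y → δ (v * v - v * z * y) ≡ δ (z * y - v)
      δ-vz p∤v z y = trans (cong δ (factor v z y)) (trans (δ-unit (v - z * y) p∤v) (δ-swap v (z * y)))

    -- Indicator of w = v + 1/v with the denominator cleared; no w satisfies this when p divides v.
    a : ℤ → ℤ → ℤ
    a v w = δ (v * w - (v * v + + 1))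

    a-zero : ∀ {v} w → + p ∣ v → a v w ≡ + 0
    a-zero {v} w d = δ-no (λ e → ∤1 (∣-lin (w - v) (- + 1) d e (lemma v w)))
      where
      lemma : ∀ v w → + 1 ≡ (w - v) * v + - + 1 * (v * w - (v * v + + 1))
      lemma = solve-∀

    -- With w = v + 1/v and w′ = z + 1/z one has z v (w - w′) = (1 - v z)(z - v).
    Y-term-as-sum : ∀ v z → Y-term v z ≡ ∑[ w < p ] ∑[ w′ < p ] (a v w * (a z w′ * η (w - w′)))
    Y-term-as-sum v z = case + p ∣? v of λ where
        (yes p∣v) → trans (cong (λ c → c * η z * (η (+ 1 - v * z) * η (z - v))) (η-∣ p∣v))
          (sym (trans (∑-cong (λ w → trans (∑-cong (λ w′ → cong (_* (a z w′ * η (w - w′))) (a-zero w p∣v))) ∑-zero)) ∑-zero))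
        (no p∤v) → case + p ∣? z of λ where
          (yes p∣z) → trans (cong (_* (η (+ 1 - v * z) * η (z - v))) (trans (cong (ℤ._*_ (η v)) (η-∣ p∣z)) (ℤP.*-zeroʳ (η v))))
            (sym (trans (∑-cong (λ w → trans (∑-cong (λ w′ → trans (cong (λ c → a v w * (c * η (w - w′))) (a-zero w′ p∣z)) (ℤP.*-zeroʳ (a v w)))) ∑-zero)) ∑-zero))
          (no p∤z) → sym (begin
            ∑[ w < p ] ∑[ w′ < p ] (a v w * (a z w′ * η (w - w′)))
              ≡⟨ ∑-cong (λ w → ∑-cong (λ w′ → δ-on (λ d → δ-on (λ e → on p∤v p∤z w w′ d e)))) ⟩
            ∑[ w < p ] ∑[ w′ < p ] (a v w * (a z w′ * Y-term v z))
              ≡⟨ ∑-cong (λ w → trans (∑-*ˡ (a v w) (λ w′ → a z w′ * Y-term v z)) (cong (ℤ._*_ (a v w))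
                   (trans (∑-*ʳ (Y-term v z) (a z)) (trans (cong (_* Y-term v z) (∑-δ-linear (z * z + + 1) p∤z)) (ℤP.*-identityˡ _))))) ⟩
            ∑[ w < p ] (a v w * Y-term v z)
              ≡⟨ trans (∑-*ʳ (Y-term v z) (a v)) (trans (cong (_* Y-term v z) (∑-δ-linear (v * v + + 1) p∤v)) (ℤP.*-identityˡ _)) ⟩
            Y-term v z ∎)
      where
      close : ∀ v z w w′ → z * v * (w - w′) - (+ 1 - v * z) * (z - v) ≡ z * (v * w - (v * v + + 1)) + - v * (z * w′ - (z * z + + 1))
      close = solve-∀
      rearrange : ∀ z v c → (z * v) * (z * v) * c ≡ v * z * (z * v * c)
      rearrange = solve-∀
      squares : ∀ z v → (z * v) * (z * v) ≡ (z * z) * (v * v)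
      squares = solve-∀
      on : ¬ + p ∣ v → ¬ + p ∣ z → ∀ w w′ → + p ∣ v * w - (v * v + + 1) → + p ∣ z * w′ - (z * z + + 1) → η (w - w′) ≡ Y-term v z
      on p∤v p∤z w w′ d e = begin
        η (w - w′)                                          ≡⟨ ℤP.*-identityˡ _ ⟨
        + 1 * η (w - w′)                                    ≡⟨ cong (_* η (w - w′)) (trans (squares (η z) (η v)) (cong₂ _*_ (η²-unit p∤z) (η²-unit p∤v))) ⟨
        (η z * η v) * (η z * η v) * η (w - w′)              ≡⟨ rearrange (η z) (η v) _ ⟩
        η v * η z * (η z * η v * η (w - w′))                ≡⟨ cong (ℤ._*_ (η v * η z)) (trans (η-* (z * v) (w - w′)) (cong (_* η (w - w′)) (η-* z v))) ⟨
        η v * η z * η (z * v * (w - w′))                    ≡⟨ cong (ℤ._*_ (η v * η z)) (η-per (mod (∣-lin z (- v) d e (close v z w w′)))) ⟩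
        η v * η z * η ((+ 1 - v * z) * (z - v))             ≡⟨ cong (ℤ._*_ (η v * η z)) (η-* _ _) ⟩
        Y-term v z                                          ∎

    b : ℤ → ℤ
    b w = η (w * w - + 4)

    b-per : Per b
    b-per e = η-per (-‿≈ (*-≈ e e) (≈-refl {+ 4}))

    -- Completing the square: v w = v² + 1 says that (2 v - w)² equals the discriminant w² - 4, and
    -- 2 v - w runs over all residues with v because p is odd.
    ∑a : ∀ w → ∑[ v < p ] a v w ≡ + 1 + b w
    ∑a w = begin
      ∑[ v < p ] δ (v * w - (v * v + + 1))                               ≡⟨ ∑-cong (λ v → sym (trans (cong δ (complete v w)) (δ-unit _ p∤4))) ⟩
      ∑[ v < p ] δ ((+ 2 * v + - w) * (+ 2 * v + - w) - (w * w - + 4))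
        ≡⟨ ∑-affine {a = + 2} {a⁻¹ = proj₁ (inverse p∤2)} (- w) (proj₂ (inverse p∤2)) (λ e → δ-per (-‿≈ (*-≈ e e) (≈-refl {w * w - + 4}))) ⟩
      roots (w * w - + 4)                                                ≡⟨ roots≡1+η p∤2 C (w * w - + 4) ⟩
      + 1 + b w                                                          ∎
      where
      complete : ∀ v w → (+ 2 * v + - w) * (+ 2 * v + - w) - (w * w - + 4) ≡ - + 4 * (v * w - (v * v + + 1))
      complete = solve-∀

    -- The constant 1 contributes only the full sum of η, which is 0. Applied in each variable in
    -- turn, this leaves the discriminant characters `b` alone.
    drop-1 : ∀ w → ∑[ w′ < p ] ((+ 1 + b w′) * η (w - w′)) ≡ ∑[ w′ < p ] (b w′ * η (w - w′))
    drop-1 w = begin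
      ∑[ w′ < p ] ((+ 1 + b w′) * η (w - w′))           ≡⟨ ∑-cong (λ w′ → expand (b w′) _) ⟩
      ∑[ w′ < p ] (η (w - w′) + b w′ * η (w - w′))      ≡⟨ ∑-distrib-+ (λ w′ → η (w - w′)) (λ w′ → b w′ * η (w - w′)) ⟩
      (∑[ w′ < p ] η (w - w′)) + (∑[ w′ < p ] (b w′ * η (w - w′)))  ≡⟨ cong (_+ (∑[ w′ < p ] (b w′ * η (w - w′)))) (trans (∑-reflect w η-per) ∑η) ⟩
      + 0 + (∑[ w′ < p ] (b w′ * η (w - w′)))           ≡⟨ ℤP.+-identityˡ _ ⟩
      ∑[ w′ < p ] (b w′ * η (w - w′))                   ∎
      where
      expand : ∀ b c → (+ 1 + b) * c ≡ c + b * c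
      expand = solve-∀

    bilinear-drop-1 : ∑[ w < p ] ((+ 1 + b w) * (∑[ w′ < p ] ((+ 1 + b w′) * η (w - w′)))) ≡ ∑[ w < p ] ∑[ w′ < p ] (b w * (b w′ * η (w - w′)))
    bilinear-drop-1 = begin
      ∑[ w < p ] ((+ 1 + b w) * (∑[ w′ < p ] ((+ 1 + b w′) * η (w - w′))))
        ≡⟨ ∑-cong (λ w → trans (cong (ℤ._*_ (+ 1 + b w)) (drop-1 w)) (sym (∑-*ˡ (+ 1 + b w) _))) ⟩
      ∑[ w < p ] ∑[ w′ < p ] ((+ 1 + b w) * (b w′ * η (w - w′)))   ≡⟨ ∑-comm _ ⟩
      ∑[ w′ < p ] ∑[ w < p ] ((+ 1 + b w) * (b w′ * η (w - w′)))
        ≡⟨ ∑-cong (λ w′ → trans (∑-cong (λ w → trans (rearrange (+ 1 + b w) (b w′) _) (cong (λ c → b w′ * ((+ 1 + b w) * c)) (η-swap w w′)))) (∑-*ˡ (b w′) _)) ⟩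
      ∑[ w′ < p ] (b w′ * (∑[ w < p ] ((+ 1 + b w) * η (w′ - w)))) ≡⟨ ∑-cong (λ w′ → trans (cong (ℤ._*_ (b w′)) (drop-1 w′)) (sym (∑-*ˡ (b w′) _))) ⟩
      ∑[ w < p ] ∑[ w′ < p ] (b w * (b w′ * η (w - w′)))           ∎
      where
      rearrange : ∀ a b c → a * (b * c) ≡ b * (a * c)
      rearrange = solve-∀

    η-4 : ∀ x → η (- + 4 * x) ≡ η x
    η-4 x = begin
      η (- + 4 * x)            ≡⟨ cong η (lemma x) ⟩
      η (- (+ 2 * (+ 2 * x)))  ≡⟨ η-even _ ⟩
      η (+ 2 * (+ 2 * x))      ≡⟨ trans (η-* (+ 2) _) (cong (ℤ._*_ (η (+ 2))) (η-* (+ 2) x)) ⟩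
      η (+ 2) * (η (+ 2) * η x) ≡⟨ ℤP.*-assoc (η (+ 2)) _ _ ⟨
      η (+ 2) * η (+ 2) * η x  ≡⟨ cong (_* η x) (η²-unit p∤2) ⟩
      + 1 * η x                ≡⟨ ℤP.*-identityˡ _ ⟩
      η x                      ∎
      where
      lemma : ∀ x → - + 4 * x ≡ - (+ 2 * (+ 2 * x))
      lemma = solve-∀

    -- The substitution w = 2 - 4 s turns w² - 4 into -16 s (1 - s).
    b-sum : ∑[ w < p ] ∑[ w′ < p ] (b w * (b w′ * η (w - w′))) ≡ X
    b-sum = begin
      ∑[ w < p ] ∑[ w′ < p ] (b w * (b w′ * η (w - w′)))
        ≡⟨ 2-4s (λ e → ∑-cong (λ w′ → cong₂ (λ u v → u * (b w′ * v)) (b-per e) (η-per (-‿≈ e (≈-refl {w′}))))) ⟨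
      ∑[ s < p ] ∑[ w′ < p ] (b (φ s) * (b w′ * η (φ s - w′)))
        ≡⟨ ∑-cong (λ s → sym (2-4s (λ e → cong₂ (λ u v → b (φ s) * (u * v)) (b-per e) (η-per (-‿≈ (≈-refl {φ s}) e))))) ⟩
      ∑[ s < p ] ∑[ t < p ] (b (φ s) * (b (φ t) * η (φ s - φ t)))
        ≡⟨ ∑-cong (λ s → ∑-cong (λ t → trans (cong₂ _*_ (b-φ s) (cong₂ _*_ (b-φ t) (trans (cong η (diff s t)) (η-4 (s - t))))) (sym (ℤP.*-assoc (k s) (k t) _)))) ⟩
      X ∎
      where
      φ : ℤ → ℤ
      φ s = - + 4 * s + + 2
      2-4s : ∀ {f} → Per f → ∑[ s < p ] f (φ s) ≡ ∑ p f
      2-4s = ∑-affine {a = - + 4} {a⁻¹ = proj₁ (inverse p∤4)} (+ 2) (proj₂ (inverse p∤4))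
      diff : ∀ s t → (- + 4 * s + + 2) - (- + 4 * t + + 2) ≡ - + 4 * (s - t)
      diff = solve-∀
      disc : ∀ s → (- + 4 * s + + 2) * (- + 4 * s + + 2) - + 4 ≡ - (- + 4 * (- + 4 * (s * (+ 1 - s))))
      disc = solve-∀
      b-φ : ∀ s → b (φ s) ≡ k s
      b-φ s = trans (cong η (disc s)) (trans (η-even (- + 4 * (- + 4 * (s * (+ 1 - s))))) (trans (η-4 (- + 4 * (s * (+ 1 - s)))) (trans (η-4 (s * (+ 1 - s))) (η-* s (+ 1 - s)))))

  -- The real part of a quartic character ψ satisfies the hypothesis: ψ (v²) = η v.
  jacobi-square : (ρ : ℤ → ℤ) → (∀ u → ∑[ v < p ] (δ (v * v - u) * η v) ≡ + 2 * ρ u) →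
    ∑[ x < p ] ∑[ y < p ] (+ 2 * ρ (x * y) * (η (+ 1 - x) * η (+ 1 - y))) ≡ X
  jacobi-square ρ 2ρ = begin
    ∑[ x < p ] ∑[ y < p ] (+ 2 * ρ (x * y) * (η (+ 1 - x) * η (+ 1 - y)))
      ≡⟨ ∑-cong (λ x → ∑-cong (λ y → trans (cong (_* (η (+ 1 - x) * η (+ 1 - y))) (sym (2ρ (x * y)))) (sym (∑-*ʳ (η (+ 1 - x) * η (+ 1 - y)) (λ v → δ (v * v - x * y) * η v))))) ⟩
    ∑[ x < p ] ∑[ y < p ] ∑[ v < p ] (δ (v * v - x * y) * η v * (η (+ 1 - x) * η (+ 1 - y)))
      ≡⟨ trans (∑-cong (λ x → ∑-comm _)) (∑-comm _) ⟩
    ∑[ v < p ] ∑[ x < p ] ∑[ y < p ] (δ (v * v - x * y) * η v * (η (+ 1 - x) * η (+ 1 - y)))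
      ≡⟨ ∑-cong (λ v → trans (xy-sum v) (∑-cong (Y-term-as-sum v))) ⟩
    ∑[ v < p ] ∑[ z < p ] ∑[ w < p ] ∑[ w′ < p ] (a v w * (a z w′ * η (w - w′)))
      -- Summing out z here, and v in the next step, replaces the indicators by the numbers of
      -- representations `∑a` of w′ and w.
      ≡⟨ ∑-cong (λ v → trans (∑-comm _) (∑-cong (λ w → trans (∑-comm _)
           (trans (∑-cong (λ w′ → trans (∑-*ˡ (a v w) (λ z → a z w′ * η (w - w′))) (cong (ℤ._*_ (a v w)) (trans (∑-*ʳ (η (w - w′)) (λ z → a z w′)) (cong (_* η (w - w′)) (∑a w′))))))
                  (∑-*ˡ (a v w) _))))) ⟩
    ∑[ v < p ] ∑[ w < p ] (a v w * (∑[ w′ < p ] ((+ 1 + b w′) * η (w - w′))))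
      ≡⟨ trans (∑-comm _) (∑-cong (λ w → trans (∑-*ʳ _ (λ v → a v w)) (cong (_* (∑[ w′ < p ] ((+ 1 + b w′) * η (w - w′)))) (∑a w)))) ⟩
    ∑[ w < p ] ((+ 1 + b w) * (∑[ w′ < p ] ((+ 1 + b w′) * η (w - w′)))) ≡⟨ bilinear-drop-1 ⟩
    ∑[ w < p ] ∑[ w′ < p ] (b w * (b w′ * η (w - w′)))                 ≡⟨ b-sum ⟩
    X                                                                  ∎

-- Sums over quadruples

module CliqueSum (p : ℕ) (pr : Prime p) (C : PrimeModulus.QuadraticCharacter p pr)
  (η-even : ∀ a → PrimeModulus.QuadraticCharacter.η C (- a) ≡ PrimeModulus.QuadraticCharacter.η C a) where

  open PrimeModulus p pr
  open QuadraticCharacter C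
  open QuadraticSums p pr C η-even

  private instance
    p≢0 : ℕ.NonZero p
    p≢0 = prime⇒nonZero pr

  clique : ℤ → ℤ → ℤ → ℤ → ℤ
  clique a b c d = g (a - b) * g (a - c) * g (a - d) * (g (b - c) * g (b - d) * g (c - d))

  clique-per₁ : ∀ b c d → Per (λ a → clique a b c d)
  clique-per₁ b c d e = cong (_* (g (b - c) * g (b - d) * g (c - d)))
    (cong₂ _*_ (cong₂ _*_ (g-per (-‿≈ e (≈-refl {b}))) (g-per (-‿≈ e (≈-refl {c})))) (g-per (-‿≈ e (≈-refl {d}))))

  clique-per₂ : ∀ a c d → Per (λ b → clique a b c d)
  clique-per₂ a c d e = cong₂ _*_ (cong (λ z → z * g (a - c) * g (a - d)) (g-per (-‿≈ (≈-refl {a}) e)))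
    (cong₂ (λ u v → u * v * g (c - d)) (g-per (-‿≈ e (≈-refl {c}))) (g-per (-‿≈ e (≈-refl {d}))))

  clique-per₃ : ∀ a b d → Per (λ c → clique a b c d)
  clique-per₃ a b d e = cong₂ _*_ (cong (λ z → g (a - b) * z * g (a - d)) (g-per (-‿≈ (≈-refl {a}) e)))
    (cong₂ (λ u v → u * g (b - d) * v) (g-per (-‿≈ (≈-refl {b}) e)) (g-per (-‿≈ e (≈-refl {d}))))

  clique-per₄ : ∀ a b c → Per (λ d → clique a b c d)
  clique-per₄ a b c e = cong₂ _*_ (cong (λ z → g (a - b) * g (a - c) * z) (g-per (-‿≈ (≈-refl {a}) e)))
    (cong₂ (λ u v → g (b - c) * u * v) (g-per (-‿≈ (≈-refl {b}) e)) (g-per (-‿≈ (≈-refl {c}) e)))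

  g-even : ∀ a → g (- a) ≡ g a
  g-even a = cong₂ (λ d c → + 1 - d + c) (δ-⇔ (λ d → subst (+ p ∣_) (ℤP.neg-involutive a) (∣ℤ.∣m⇒∣-m d)) ∣ℤ.∣m⇒∣-m) (η-even a)

  g-swap : ∀ a b → g (a - b) ≡ g (b - a)
  g-swap a b = trans (cong g (flip a b)) (g-even (b - a))
    where
    flip : ∀ a b → a - b ≡ - (b - a)
    flip = solve-∀

  ∑g : ∑ p g ≡ + p - + 1
  ∑g = begin
    ∑[ x < p ] (+ 1 - δ x + η x)            ≡⟨ ∑-distrib-+ (λ x → + 1 - δ x) η ⟩
    (∑[ x < p ] (+ 1 - δ x)) + ∑ p η        ≡⟨ cong₂ _+_ (trans (∑-distrib-minus (λ _ → + 1) δ) (cong₂ _-_ ∑-one ∑-δ₀)) ∑η ⟩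
    (+ p - + 1) + + 0                       ≡⟨ ℤP.+-identityʳ _ ⟩
    + p - + 1                               ∎

  private
    -- Weighted number of ways to complete the vertices 0 and b; the weight g b of the edge between
    -- them is kept outside.
    N : ℤ → ℤ
    N b = ∑[ c < p ] ∑[ d < p ] (g c * g d * (g (b - c) * g (b - d) * g (c - d)))

    translate : ∀ a → ∑[ b < p ] ∑[ c < p ] ∑[ d < p ] clique a b c d ≡ ∑[ b < p ] (g b * N b)
    translate a = begin
      ∑[ b < p ] ∑[ c < p ] ∑[ d < p ] clique a b c d
        ≡⟨ ∑-translate a (λ e → ∑-cong (λ c → ∑-cong (λ d → clique-per₂ a c d e))) ⟨
      ∑[ b < p ] ∑[ c < p ] ∑[ d < p ] clique a (b + a) c d
        ≡⟨ ∑-cong (λ b → sym (∑-translate a (λ e → ∑-cong (λ d → clique-per₃ a (b + a) d e)))) ⟩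
      ∑[ b < p ] ∑[ c < p ] ∑[ d < p ] clique a (b + a) (c + a) d
        ≡⟨ ∑-cong (λ b → ∑-cong (λ c → sym (∑-translate a (clique-per₄ a (b + a) (c + a))))) ⟩
      ∑[ b < p ] ∑[ c < p ] ∑[ d < p ] clique a (b + a) (c + a) (d + a)
        ≡⟨ ∑-cong (λ b → trans (∑-cong (λ c → trans (∑-cong (shifted b c)) (∑-*ˡ (g b) _))) (∑-*ˡ (g b) _)) ⟩
      ∑[ b < p ] (g b * N b) ∎
      where
      cancel : ∀ a b → a - (b + a) ≡ - b
      cancel = solve-∀
      cancel′ : ∀ a b c → (b + a) - (c + a) ≡ b - c
      cancel′ = solve-∀
      g₁ : ∀ b → g (a - (b + a)) ≡ g b
      g₁ b = trans (cong g (cancel a b)) (g-even b)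
      g₂ : ∀ b c → g ((b + a) - (c + a)) ≡ g (b - c)
      g₂ b c = cong g (cancel′ a b c)
      rearrange : ∀ b c d x → b * c * d * x ≡ b * (c * d * x)
      rearrange = solve-∀
      shifted : ∀ b c d → clique a (b + a) (c + a) (d + a) ≡ g b * (g c * g d * (g (b - c) * g (b - d) * g (c - d)))
      shifted b c d = trans (cong₂ _*_ (cong₂ _*_ (cong₂ _*_ (g₁ b) (g₁ c)) (g₁ d)) (cong₂ _*_ (cong₂ _*_ (g₂ b c) (g₂ b d)) (g₂ c d)))
        (rearrange (g b) (g c) (g d) _)

    -- Multiplication by a nonzero square b preserves `g`, so the edge 0, b can be scaled to the
    -- edge 0, 1.
    N-residue : ∀ {b} → ¬ + p ∣ b → η b ≡ + 1 → N b ≡ M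
    N-residue {b} p∤b ηb≡1 = begin
      N b ≡⟨ scale (λ e → ∑-cong (λ d → cong₂ _*_ (cong (_* g d) (g-per e))
               (cong₂ (λ u v → u * g (b - d) * v) (g-per (-‿≈ (≈-refl {b}) e)) (g-per (-‿≈ e (≈-refl {d})))))) ⟨
      ∑[ c < p ] ∑[ d < p ] (g (b * c) * g d * (g (b - b * c) * g (b - d) * g (b * c - d)))
          ≡⟨ ∑-cong (λ c → sym (scale (λ e → cong₂ _*_ (cong (ℤ._*_ (g (b * c))) (g-per e))
               (cong₂ (λ u v → g (b - b * c) * u * v) (g-per (-‿≈ (≈-refl {b}) e)) (g-per (-‿≈ (≈-refl {b * c}) e)))))) ⟩
      ∑[ c < p ] ∑[ d < p ] (g (b * c) * g (b * d) * (g (b - b * c) * g (b - b * d) * g (b * c - b * d)))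
          ≡⟨ ∑-cong (λ c → ∑-cong (λ d → trans
               (cong₂ _*_ (cong₂ _*_ (g-b c) (g-b d)) (cong₂ _*_ (cong₂ _*_ (g-1 c) (g-1 d)) (trans (cong g (factor b c d)) (g-b (c - d)))))
               (rearrange (g c) (g d) (g (+ 1 - c)) (g (+ 1 - d)) (g (c - d))))) ⟩
      M ∎
      where
      scale : ∀ {f} → Per f → ∑[ x < p ] f (b * x) ≡ ∑ p f
      scale = ∑-scale {a = b} {a⁻¹ = proj₁ (inverse p∤b)} (proj₂ (inverse p∤b))
      factor : ∀ b c d → b * c - b * d ≡ b * (c - d)
      factor = solve-∀
      factor′ : ∀ b c → b - b * c ≡ b * (+ 1 - c)
      factor′ = solve-∀
      rearrange : ∀ c d c′ d′ x → c * d * (c′ * d′ * x) ≡ c * c′ * (d * d′) * x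
      rearrange = solve-∀
      g-b : ∀ x → g (b * x) ≡ g x
      g-b x = cong₂ (λ u v → + 1 - u + v) (δ-unit x p∤b) (trans (η-* b x) (trans (cong (_* η x) ηb≡1) (ℤP.*-identityˡ _)))
      g-1 : ∀ c → g (b - b * c) ≡ g (+ 1 - c)
      g-1 c = trans (cong g (factor′ b c)) (g-b (+ 1 - c))

    gN : ∀ b → g b * N b ≡ g b * M
    gN b = case + p ∣? b of λ where
          (yes p∣b) → both-zero (cong₂ (λ u v → + 1 - u + v) (δ-yes p∣b) (η-∣ p∣b))
          (no p∤b)  → case η-unit p∤b of λ where
            (inj₁ ηb≡1)  → cong (ℤ._*_ (g b)) (N-residue p∤b ηb≡1)
            (inj₂ ηb≡-1) → both-zero (cong₂ (λ u v → + 1 - u + v) (δ-no p∤b) ηb≡-1)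
      where
      both-zero : g b ≡ + 0 → g b * N b ≡ g b * M
      both-zero e = trans (cong (_* N b) e) (sym (cong (_* M) e))

  ∑-clique : ∑[ a < p ] ∑[ b < p ] ∑[ c < p ] ∑[ d < p ] clique a b c d ≡ + p * ((+ p - + 1) * M)
  ∑-clique = begin
    ∑[ a < p ] ∑[ b < p ] ∑[ c < p ] ∑[ d < p ] clique a b c d ≡⟨ ∑-cong (λ a → trans (translate a) (trans (∑-cong gN) (trans (∑-*ʳ M g) (cong (_* M) ∑g)))) ⟩
    ∑[ a < p ] ((+ p - + 1) * M)           ≡⟨ ∑-cong (λ _ → sym (ℤP.*-identityˡ ((+ p - + 1) * M))) ⟩
    ∑[ a < p ] (+ 1 * ((+ p - + 1) * M))   ≡⟨ ∑-*ʳ ((+ p - + 1) * M) (λ _ → + 1) ⟩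
    (∑[ a < p ] + 1) * ((+ p - + 1) * M)   ≡⟨ cong (_* ((+ p - + 1) * M)) ∑-one ⟩
    + p * ((+ p - + 1) * M)                ∎

∑⁴ : ℕ → (ℤ → ℤ → ℤ → ℤ → ℤ) → ℤ
∑⁴ n F = ∑[ a < n ] ∑[ b < n ] ∑[ c < n ] ∑[ d < n ] F a b c d

∑⁴-cong : ∀ {n F G} → (∀ a b c d → F a b c d ≡ G a b c d) → ∑⁴ n F ≡ ∑⁴ n G
∑⁴-cong e = ∑-cong (λ a → ∑-cong (λ b → ∑-cong (λ c → ∑-cong (e a b c))))

∑⁴-distrib-+ : ∀ {n} F G → ∑⁴ n (λ a b c d → F a b c d + G a b c d) ≡ ∑⁴ n F + ∑⁴ n G
∑⁴-distrib-+ F G =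
  trans (∑-cong (λ a → trans (∑-cong (λ b → trans (∑-cong (λ c → ∑-distrib-+ (F a b c) (G a b c))) (∑-distrib-+ _ _))) (∑-distrib-+ _ _))) (∑-distrib-+ _ _)

opaque
  unfolding ind

  ind-⇔ : ∀ {A B : Set} (A? : Dec A) (B? : Dec B) → (A → B) → (B → A) → ind A? ≡ ind B?
  ind-⇔ (yes _) (yes _) f g = refl
  ind-⇔ (yes a) (no ¬b) f g = ⊥-elim (¬b (f a))
  ind-⇔ (no ¬a) (yes b) f g = ⊥-elim (¬a (g b))
  ind-⇔ (no _)  (no _)  f g = refl

  ind-× : ∀ {A B : Set} (A? : Dec A) (B? : Dec B) → ind (A? ×-dec B?) ≡ ind A? * ind B?
  ind-× (yes _) (yes _) = refl
  ind-× (yes _) (no _)  = refl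
  ind-× (no _)  (yes _) = refl
  ind-× (no _)  (no _)  = refl

-- Opaque, since conversion checking would otherwise unroll the multiplication by a literal k.
opaque
  weighted : ∀ {A : Set} → ℤ → Dec A → ℤ
  weighted k A? = k * ind A?

opaque
  unfolding weighted

  -- The 64 is spent as one factor 2 on each of the six edges, because `g` is twice the adjacency
  -- indicator; the three order indicators keep weight 1.
  ind-ordered-clique : ∀ {X Y Z A B C D E F : Set} (x? : Dec X) (y? : Dec Y) (z? : Dec Z)
    (a? : Dec A) (b? : Dec B) (c? : Dec C) (d? : Dec D) (e? : Dec E) (f? : Dec F) →
    ∀ x y z a b c d e f →
    ind x? ≡ x → ind y? ≡ y → ind z? ≡ z →
    + 2 * ind a? ≡ a → + 2 * ind b? ≡ b → + 2 * ind c? ≡ c → + 2 * ind d? ≡ d → + 2 * ind e? ≡ e → + 2 * ind f? ≡ f →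
    weighted (+ 64) ((x? ×-dec y? ×-dec z?) ×-dec (a? ×-dec b? ×-dec c? ×-dec d? ×-dec e? ×-dec f?)) ≡ x * y * z * (a * b * c * (d * e * f))
  ind-ordered-clique x? y? z? a? b? c? d? e? f? _ _ _ _ _ _ _ _ _ refl refl refl refl refl refl refl refl refl =
    trans (cong (ℤ._*_ (+ 64)) (trans (ind-× (x? ×-dec y? ×-dec z?) (a? ×-dec b? ×-dec c? ×-dec d? ×-dec e? ×-dec f?)) (cong₂ _*_
      (trans (ind-× x? (y? ×-dec z?)) (cong (ℤ._*_ (ind x?)) (ind-× y? z?)))
      (trans (ind-× a? (b? ×-dec c? ×-dec d? ×-dec e? ×-dec f?)) (cong (ℤ._*_ (ind a?))
      (trans (ind-× b? (c? ×-dec d? ×-dec e? ×-dec f?)) (cong (ℤ._*_ (ind b?))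
      (trans (ind-× c? (d? ×-dec e? ×-dec f?)) (cong (ℤ._*_ (ind c?))
      (trans (ind-× d? (e? ×-dec f?)) (cong (ℤ._*_ (ind d?)) (ind-× e? f?))))))))))))
    (distribute (ind x?) (ind y?) (ind z?) (ind a?) (ind b?) (ind c?) (ind d?) (ind e?) (ind f?))
    where
    distribute : ∀ x y z a b c d e f → + 64 * ((x * (y * z)) * (a * (b * (c * (d * (e * f)))))) ≡
      x * y * z * ((+ 2 * a) * (+ 2 * b) * (+ 2 * c) * ((+ 2 * d) * (+ 2 * e) * (+ 2 * f)))
    distribute = solve-∀

opaque
  unfolding ind

  L : ℤ → ℤ → ℤ
  L x y = ind (x ℤ.<? y)

  L-ind : ∀ {A : Set} (A? : Dec A) {x y} → (A → x ℤ.< y) → (x ℤ.< y → A) → ind A? ≡ L x y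
  L-ind A? {x} {y} = ind-⇔ A? (x ℤ.<? y)

  L-trans : ∀ x y z → L x y * L y z * L x z ≡ L x y * L y z
  L-trans x y z with x ℤ.<? y | y ℤ.<? z | x ℤ.<? z
  ... | yes _   | yes _   | yes _   = refl
  ... | yes x<y | yes y<z | no x≮z = ⊥-elim (x≮z (ℤP.<-trans x<y y<z))
  ... | yes _   | no _    | _       = refl
  ... | no _    | _       | _       = refl

  -- Trichotomy. A tie is harmless because the weight of a quadruple with a repeated vertex is 0.
  L-total : ∀ x y {w} → (x ≡ y → w ≡ + 0) → (L x y + L y x) * w ≡ w
  L-total x y {w} z with x ℤ.<? y | y ℤ.<? x | ℤP.<-cmp x y
  ... | yes x<y | yes y<x | _ = ⊥-elim (ℤP.<-asym x<y y<x)
  ... | yes _   | no _    | _ = ℤP.*-identityˡ w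
  ... | no _    | yes _   | _ = ℤP.*-identityˡ w
  ... | no x≮y  | no y≮x  | tri< x<y _ _ = ⊥-elim (x≮y x<y)
  ... | no x≮y  | no y≮x  | tri≈ _ x≡y _ = trans (ℤP.*-zeroˡ w) (sym (z x≡y))
  ... | no x≮y  | no y≮x  | tri> _ _ y<x = ⊥-elim (y≮x y<x)

-- From all quadruples to increasing ones

module Ordering (n : ℕ) (W : ℤ → ℤ → ℤ → ℤ → ℤ)
  (sym₁₂ : ∀ a b c d → W b a c d ≡ W a b c d) (sym₂₃ : ∀ a b c d → W a c b d ≡ W a b c d) (sym₃₄ : ∀ a b c d → W a b d c ≡ W a b c d)
  (W-≡ : ∀ b c d → W b b c d ≡ + 0) where

  private
    swap₁₂ : (φ : ℤ → ℤ → ℤ → ℤ → ℤ) → ∑⁴ n (λ a b c d → φ b a c d * W a b c d) ≡ ∑⁴ n (λ a b c d → φ a b c d * W a b c d)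
    swap₁₂ φ = trans (∑-comm _) (∑⁴-cong (λ a b c d → cong (ℤ._*_ (φ a b c d)) (sym₁₂ a b c d)))

    swap₂₃ : (φ : ℤ → ℤ → ℤ → ℤ → ℤ) → ∑⁴ n (λ a b c d → φ a c b d * W a b c d) ≡ ∑⁴ n (λ a b c d → φ a b c d * W a b c d)
    swap₂₃ φ = trans (∑-cong (λ a → ∑-comm _)) (∑⁴-cong (λ a b c d → cong (ℤ._*_ (φ a b c d)) (sym₂₃ a b c d)))

    swap₃₄ : (φ : ℤ → ℤ → ℤ → ℤ → ℤ) → ∑⁴ n (λ a b c d → φ a b d c * W a b c d) ≡ ∑⁴ n (λ a b c d → φ a b c d * W a b c d)
    swap₃₄ φ = trans (∑-cong (λ a → ∑-cong (λ b → ∑-comm _))) (∑⁴-cong (λ a b c d → cong (ℤ._*_ (φ a b c d)) (sym₃₄ a b c d)))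

    W-≡₁₃ : ∀ a b d → W a b a d ≡ + 0
    W-≡₁₃ a b d = trans (sym₂₃ a a b d) (W-≡ a b d)

    W-≡₂₃ : ∀ a b d → W a b b d ≡ + 0
    W-≡₂₃ a b d = trans (sym (sym₁₂ a b b d)) (W-≡₁₃ b a d)

    W-≡₁₄ : ∀ a b c → W a b c a ≡ + 0
    W-≡₁₄ a b c = trans (sym₃₄ a b a c) (W-≡₁₃ a b c)

    W-≡₂₄ : ∀ a b c → W a b c b ≡ + 0
    W-≡₂₄ a b c = trans (sym₃₄ a b b c) (W-≡₂₃ a b c)

    W-≡₃₄ : ∀ a b c → W a b c c ≡ + 0
    W-≡₃₄ a b c = trans (sym (sym₂₃ a b c c)) (W-≡₂₄ a c b)

    -- Indicators that the last two, three or four entries increase. The entries are sorted by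
    -- insertion from the right, with 2, 3 and 4 possible places, whence 24 = 2 · 3 · 4.
    φ₂ φ₃ φ₄ : ℤ → ℤ → ℤ → ℤ → ℤ
    φ₂ a b c d = L c d
    φ₃ a b c d = L b c * L c d
    φ₄ a b c d = L a b * L b c * L c d

    S : (ℤ → ℤ → ℤ → ℤ → ℤ) → ℤ
    S φ = ∑⁴ n (λ a b c d → φ a b c d * W a b c d)

    step₂ : ∑⁴ n W ≡ + 2 * S φ₂
    step₂ = begin
      ∑⁴ n W                                                                       ≡⟨ ∑⁴-cong (λ a b c d → split a b c d) ⟩
      ∑⁴ n (λ a b c d → φ₂ a b c d * W a b c d + φ₂ a b d c * W a b c d)           ≡⟨ ∑⁴-distrib-+ (λ a b c d → φ₂ a b c d * W a b c d) _ ⟩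
      S φ₂ + S (λ a b c d → φ₂ a b d c)                                            ≡⟨ cong (ℤ._+_ (S φ₂)) (swap₃₄ φ₂) ⟩
      S φ₂ + S φ₂                                                                  ≡⟨ double (S φ₂) ⟩
      + 2 * S φ₂                                                                   ∎
      where
      double : ∀ x → x + x ≡ + 2 * x
      double = solve-∀
      split : ∀ a b c d → W a b c d ≡ L c d * W a b c d + L d c * W a b c d
      split a b c d = trans (sym (L-total c d λ { refl → W-≡₃₄ a b c })) (ℤP.*-distribʳ-+ (W a b c d) (L c d) (L d c))

    -- The entry b lies before, between or after c < d. `L-trans` deletes the comparison implied by
    -- the other two, and the symmetry of W renames each case to b < c < d.
    step₃ : S φ₂ ≡ + 3 * S φ₃
    step₃ = begin
      S φ₂ ≡⟨ ∑⁴-cong split ⟩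
      ∑⁴ n (λ a b c d → φ₃ a b c d * W a b c d + φ₃ a c b d * W a b c d + φ₃ a c d b * W a b c d)
        ≡⟨ trans (∑⁴-distrib-+ (λ a b c d → φ₃ a b c d * W a b c d + φ₃ a c b d * W a b c d) _) (cong (_+ S (λ a b c d → φ₃ a c d b)) (∑⁴-distrib-+ (λ a b c d → φ₃ a b c d * W a b c d) _)) ⟩
      S φ₃ + S (λ a b c d → φ₃ a c b d) + S (λ a b c d → φ₃ a c d b)
        ≡⟨ cong₂ (λ u v → S φ₃ + u + v) (swap₂₃ φ₃) (trans (swap₂₃ (λ a b c d → φ₃ a b d c)) (swap₃₄ φ₃)) ⟩
      S φ₃ + S φ₃ + S φ₃ ≡⟨ triple (S φ₃) ⟩
      + 3 * S φ₃ ∎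
      where
      triple : ∀ x → x + x + x ≡ + 3 * x
      triple = solve-∀
      e₁ : ∀ cd bc cb w → cd * ((bc + cb) * w) ≡ bc * cd * w + cb * cd * w
      e₁ = solve-∀
      e₂ : ∀ cd cb bd db w → cb * cd * ((bd + db) * w) ≡ cb * bd * cd * w + cd * db * cb * w
      e₂ = solve-∀
      split : ∀ a b c d → L c d * W a b c d ≡ L b c * L c d * W a b c d + L c b * L b d * W a b c d + L c d * L d b * W a b c d
      split a b c d = begin
        L c d * w                                                     ≡⟨ cong (ℤ._*_ (L c d)) (L-total b c λ { refl → W-≡₂₃ a b d }) ⟨
        L c d * ((L b c + L c b) * w)                                 ≡⟨ e₁ (L c d) (L b c) (L c b) w ⟩
        L b c * L c d * w + L c b * L c d * w                         ≡⟨ cong (λ z → L b c * L c d * w + L c b * L c d * z) (L-total b d λ { refl → W-≡₂₄ a b c }) ⟨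
        L b c * L c d * w + L c b * L c d * ((L b d + L d b) * w)     ≡⟨ cong (ℤ._+_ (L b c * L c d * w)) (e₂ (L c d) (L c b) (L b d) (L d b) w) ⟩
        L b c * L c d * w + (L c b * L b d * L c d * w + L c d * L d b * L c b * w)
          ≡⟨ cong₂ (λ u v → L b c * L c d * w + (u * w + v * w)) (L-trans c b d) (L-trans c d b) ⟩
        L b c * L c d * w + (L c b * L b d * w + L c d * L d b * w)   ≡⟨ ℤP.+-assoc (L b c * L c d * w) _ _ ⟨
        L b c * L c d * w + L c b * L b d * w + L c d * L d b * w     ∎
        where
        w : ℤ
        w = W a b c d

    step₄ : S φ₃ ≡ + 4 * S φ₄
    step₄ = begin
      S φ₃ ≡⟨ ∑⁴-cong split ⟩
      ∑⁴ n (λ a b c d → φ₄ a b c d * W a b c d + φ₄ b a c d * W a b c d + φ₄ b c a d * W a b c d + φ₄ b c d a * W a b c d)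
        ≡⟨ trans (∑⁴-distrib-+ (λ a b c d → φ₄ a b c d * W a b c d + φ₄ b a c d * W a b c d + φ₄ b c a d * W a b c d) _) (cong (_+ S (λ a b c d → φ₄ b c d a))
             (trans (∑⁴-distrib-+ (λ a b c d → φ₄ a b c d * W a b c d + φ₄ b a c d * W a b c d) _) (cong (_+ S (λ a b c d → φ₄ b c a d))
               (∑⁴-distrib-+ (λ a b c d → φ₄ a b c d * W a b c d) _)))) ⟩
      S φ₄ + S (λ a b c d → φ₄ b a c d) + S (λ a b c d → φ₄ b c a d) + S (λ a b c d → φ₄ b c d a)
        -- The orders b c a d and b c d a are undone by two and three adjacent transpositions.
        ≡⟨ cong₂ (λ u v → S φ₄ + S (λ a b c d → φ₄ b a c d) + u + v)
             (trans (swap₁₂ (λ a b c d → φ₄ a c b d)) (swap₂₃ φ₄))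
             (trans (swap₁₂ (λ a b c d → φ₄ a c d b)) (trans (swap₂₃ (λ a b c d → φ₄ a b d c)) (swap₃₄ φ₄))) ⟩
      S φ₄ + S (λ a b c d → φ₄ b a c d) + S φ₄ + S φ₄ ≡⟨ cong (λ u → S φ₄ + u + S φ₄ + S φ₄) (swap₁₂ φ₄) ⟩
      S φ₄ + S φ₄ + S φ₄ + S φ₄ ≡⟨ quadruple (S φ₄) ⟩
      + 4 * S φ₄ ∎
      where
      quadruple : ∀ x → x + x + x + x ≡ + 4 * x
      quadruple = solve-∀
      e₁ : ∀ bc cd ab ba w → bc * cd * ((ab + ba) * w) ≡ ab * bc * cd * w + ba * bc * cd * w
      e₁ = solve-∀
      e₂ : ∀ bc cd ba ac ca w → ba * bc * cd * ((ac + ca) * w) ≡ ba * ac * bc * cd * w + bc * ca * ba * cd * w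
      e₂ = solve-∀
      e₃ : ∀ bc cd ca ad da w → bc * ca * cd * ((ad + da) * w) ≡ bc * (ca * ad * cd) * w + bc * (cd * da * ca) * w
      e₃ = solve-∀
      split : ∀ a b c d → L b c * L c d * W a b c d ≡ φ₄ a b c d * W a b c d + φ₄ b a c d * W a b c d + φ₄ b c a d * W a b c d + φ₄ b c d a * W a b c d
      split a b c d = begin
        L b c * L c d * w ≡⟨ cong (ℤ._*_ (L b c * L c d)) (L-total a b λ { refl → W-≡ a c d }) ⟨
        L b c * L c d * ((L a b + L b a) * w) ≡⟨ e₁ (L b c) (L c d) (L a b) (L b a) w ⟩
        t₁ + L b a * L b c * L c d * w
          ≡⟨ cong (ℤ._+_ t₁) (trans (cong (ℤ._*_ (L b a * L b c * L c d)) (sym (L-total a c λ { refl → W-≡₁₃ a b d }))) (e₂ (L b c) (L c d) (L b a) (L a c) (L c a) w)) ⟩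
        t₁ + (L b a * L a c * L b c * L c d * w + L b c * L c a * L b a * L c d * w)
          ≡⟨ cong₂ (λ u v → t₁ + (u * L c d * w + v * L c d * w)) (L-trans b a c) (L-trans b c a) ⟩
        t₁ + (t₂ + L b c * L c a * L c d * w)
          ≡⟨ cong (λ z → t₁ + (t₂ + z)) (trans (cong (ℤ._*_ (L b c * L c a * L c d)) (sym (L-total a d λ { refl → W-≡₁₄ a b c }))) (e₃ (L b c) (L c d) (L c a) (L a d) (L d a) w)) ⟩
        t₁ + (t₂ + (L b c * (L c a * L a d * L c d) * w + L b c * (L c d * L d a * L c a) * w))
          ≡⟨ cong₂ (λ u v → t₁ + (t₂ + (L b c * u * w + L b c * v * w))) (L-trans c a d) (L-trans c d a) ⟩
        t₁ + (t₂ + (L b c * (L c a * L a d) * w + L b c * (L c d * L d a) * w))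
          ≡⟨ regroup t₁ t₂ (L b c) (L c a) (L a d) (L c d) (L d a) w ⟩
        t₁ + t₂ + φ₄ b c a d * w + φ₄ b c d a * w ∎
        where
        w t₁ t₂ : ℤ
        w = W a b c d
        t₁ = φ₄ a b c d * w
        t₂ = φ₄ b a c d * w
        regroup : ∀ t₁ t₂ bc ca ad cd da w → t₁ + (t₂ + (bc * (ca * ad) * w + bc * (cd * da) * w)) ≡ t₁ + t₂ + bc * ca * ad * w + bc * cd * da * w
        regroup = solve-∀

  ∑⁴-ordered : ∑⁴ n W ≡ + 24 * ∑⁴ n (λ a b c d → L a b * L b c * L c d * W a b c d)
  ∑⁴-ordered = trans step₂ (trans (cong (ℤ._*_ (+ 2)) (trans step₃ (cong (ℤ._*_ (+ 3)) step₄))) (lemma (S φ₄)))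
    where
    lemma : ∀ x → + 2 * (+ 3 * (+ 4 * x)) ≡ + 24 * x
    lemma = solve-∀

-- Cut the range into q blocks of length p; periodicity makes each equal to the first.
∑-blocks : ∀ {p f} q → Congruence.Per p f → ∑ (q ℕ.* p) f ≡ + q * ∑ p f
∑-blocks {p} {f} zero per = trans (∑0 f) (sym (ℤP.*-zeroˡ (∑ p f)))
  where
  opaque
    unfolding ∑
    ∑0 : ∀ f → ∑ 0 f ≡ + 0
    ∑0 f = refl
∑-blocks {p} {f} (suc q) per = begin
  ∑ (p ℕ.+ q ℕ.* p) f                               ≡⟨ ∑-++ p (q ℕ.* p) ⟩
  ∑ p f + (∑[ x < q ℕ.* p ] f (+ p + x))            ≡⟨ cong (ℤ._+_ (∑ p f)) (∑-cong (λ x → per (Congruence.mod (divides (+ 1) (lemma (+ p) x))))) ⟩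
  ∑ p f + ∑ (q ℕ.* p) f                             ≡⟨ cong (ℤ._+_ (∑ p f)) (∑-blocks q per) ⟩
  ∑ p f + + q * ∑ p f                               ≡⟨ lemma′ (+ q) (∑ p f) ⟩
  + suc q * ∑ p f                                   ∎
  where
  lemma : ∀ p x → (p + x) - x ≡ + 1 * p
  lemma = solve-∀
  lemma′ : ∀ q s → s + q * s ≡ (+ 1 + q) * s
  lemma′ = solve-∀

-- Sums over lists

sumOver : {A : Set} → (A → ℤ) → List A → ℤ
sumOver f = foldr (λ x s → f x + s) (+ 0)

sumOver-cong : {A : Set} {f g : A → ℤ} (xs : List A) → (∀ x → f x ≡ g x) → sumOver f xs ≡ sumOver g xs
sumOver-cong []       e = refl
sumOver-cong (x ∷ xs) e = cong₂ _+_ (e x) (sumOver-cong xs e)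

sumOver-*ˡ : {A : Set} (k : ℤ) (f : A → ℤ) (xs : List A) → k * sumOver f xs ≡ sumOver (λ x → k * f x) xs
sumOver-*ˡ k f []       = ℤP.*-zeroʳ k
sumOver-*ˡ k f (x ∷ xs) = trans (ℤP.*-distribˡ-+ k (f x) _) (cong (ℤ._+_ (k * f x)) (sumOver-*ˡ k f xs))

sumOver-++ : {A : Set} (f : A → ℤ) (xs ys : List A) → sumOver f (xs ++ ys) ≡ sumOver f xs + sumOver f ys
sumOver-++ f []       ys = sym (ℤP.+-identityˡ _)
sumOver-++ f (x ∷ xs) ys = trans (cong (ℤ._+_ (f x)) (sumOver-++ f xs ys)) (sym (ℤP.+-assoc (f x) _ _))

sumOver-concatMap : {A B : Set} (f : B → ℤ) (h : A → List B) (xs : List A) → sumOver f (concatMap h xs) ≡ sumOver (λ x → sumOver f (h x)) xs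
sumOver-concatMap f h []       = refl
sumOver-concatMap f h (x ∷ xs) = trans (sumOver-++ f (h x) _) (cong (ℤ._+_ (sumOver f (h x))) (sumOver-concatMap f h xs))

sumOver-map : {A B : Set} (f : B → ℤ) (h : A → B) (xs : List A) → sumOver f (map h xs) ≡ sumOver (f ∘ h) xs
sumOver-map f h []       = refl
sumOver-map f h (x ∷ xs) = cong (ℤ._+_ (f (h x))) (sumOver-map f h xs)

opaque
  unfolding ind

  length-filter : {A : Set} {P : A → Set} (P? : ∀ x → Dec (P x)) (xs : List A) → + length (filter P? xs) ≡ sumOver (ind ∘ P?) xs
  length-filter P? [] = refl
  length-filter P? (x ∷ xs) with P? x
  ... | yes _ = cong (λ z → + 1 + z) (length-filter P? xs)
  ... | no _  = trans (length-filter P? xs) (sym (ℤP.+-identityˡ _))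

opaque
  unfolding weighted

  weighted-length-filter : ∀ k {A : Set} {P : A → Set} (P? : ∀ x → Dec (P x)) (xs : List A) {m} → m ≡ length (filter P? xs) →
    k * + m ≡ sumOver (weighted k ∘ P?) xs
  weighted-length-filter k P? xs refl = trans (cong (ℤ._*_ k) (length-filter P? xs)) (sumOver-*ˡ k (ind ∘ P?) xs)

opaque
  unfolding ∑

  sumOver-tabulate : ∀ {A : Set} {n} (g : Fin n → A) {f F} → (∀ i → f (g i) ≡ F (+ toℕ i)) → sumOver f (tabulate g) ≡ ∑ n F
  sumOver-tabulate {n = zero}  g e = refl
  sumOver-tabulate {n = suc n} g {f} {F} e = cong₂ _+_ (e Fin.zero) (sumOver-tabulate (g ∘ Fin.suc) {f} {λ x → F (+ 1 + x)} (e ∘ Fin.suc))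

  sumOver-applyUpTo : ∀ n (g : ℕ → ℕ) {f : ℕ → ℤ} {F} → (∀ i → f (g i) ≡ F (+ i)) → sumOver f (applyUpTo g n) ≡ ∑ n F
  sumOver-applyUpTo zero    g e = refl
  sumOver-applyUpTo (suc n) g {f} {F} e = cong₂ _+_ (e 0) (sumOver-applyUpTo n (g ∘ suc) {f} {λ x → F (+ 1 + x)} (e ∘ suc))

sumOver-allFin : ∀ {n} {f : Fin n → ℤ} {F} → (∀ i → f i ≡ F (+ toℕ i)) → sumOver f (allFin n) ≡ ∑ n F
sumOver-allFin = sumOver-tabulate (λ i → i)

-- Hensel lifting

open PrimeModulus using (inverse; ∤-*)

-- Newton step: if x² - m = e P, then x + t P has error (e + 2 x t + t² P) P, and t = -e / (2 x)
-- modulo p makes the bracket divisible by p. Recording x ≡ x₀ keeps x a unit, and it lets a root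
-- near 1 be lifted to a root near 1, so that roots can be taken twice.
hensel-sqrt : ∀ {p} (pr : Prime p) → ¬ + p ∣ + 2 → ∀ {m x₀} → ¬ + p ∣ x₀ → + p ∣ x₀ * x₀ - m → ∀ k →
  ∃ λ x → (+ p ∣ x - x₀) × (+ (p ℕ.^ suc k) ∣ x * x - m)
hensel-sqrt {p} pr p∤2 {m} {x₀} p∤x₀ d zero =
  x₀ , divides (+ 0) (ℤP.+-inverseʳ x₀) , subst (λ n → + n ∣ x₀ * x₀ - m) (sym (ℕP.*-identityʳ p)) d
hensel-sqrt {p} pr p∤2 {m} {x₀} p∤x₀ d (suc k) with hensel-sqrt pr p∤2 {m} {x₀} p∤x₀ d k
... | x , p∣x-x₀ , divides e x²-m≡eP = x + t * P , p∣x′-x₀ , pP∣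
  where
  P : ℤ
  P = + (p ℕ.^ suc k)
  p∤x : ¬ + p ∣ x
  p∤x p∣x = p∤x₀ (∣-lin (+ 1) (- + 1) p∣x p∣x-x₀ (lemma x x₀))
    where
    lemma : ∀ x x₀ → x₀ ≡ + 1 * x + - + 1 * (x - x₀)
    lemma = solve-∀
  2x⁻¹ : ∃ λ y → Congruence._≈_ p ((+ 2 * x) * y) (+ 1)
  2x⁻¹ = inverse p pr (∤-* p pr (+ 2) x p∤2 p∤x)
  t : ℤ
  t = - e * proj₁ 2x⁻¹
  p∣P : + p ∣ P
  p∣P = divides (+ (p ℕ.^ k)) (trans (ℤP.pos-* p (p ℕ.^ k)) (ℤP.*-comm (+ p) (+ (p ℕ.^ k))))
  p∣x′-x₀ : + p ∣ x + t * P - x₀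
  p∣x′-x₀ = ∣-lin (+ 1) t p∣x-x₀ p∣P (lemma x x₀ t P)
    where
    lemma : ∀ x x₀ t P → x + t * P - x₀ ≡ + 1 * (x - x₀) + t * P
    lemma = solve-∀
  pP∣ : + (p ℕ.^ suc (suc k)) ∣ (x + t * P) * (x + t * P) - m
  pP∣ = subst (_∣ (x + t * P) * (x + t * P) - m) (sym (ℤP.pos-* p (p ℕ.^ suc k)))
          (subst (+ p * P ∣_) (sym expand) (∣ℤ.*-monoˡ-∣ P (∣-lin (- e) (t * t) (Congruence.≈⇒∣ (proj₂ 2x⁻¹)) p∣P (lemma x e (proj₁ 2x⁻¹) P))))
    where
    lemma : ∀ x e y P → e + + 2 * x * (- e * y) + (- e * y) * (- e * y) * P ≡ - e * (+ 2 * x * y - + 1) + (- e * y) * (- e * y) * P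
    lemma = solve-∀
    split : ∀ x t P m → (x + t * P) * (x + t * P) - m ≡ (x * x - m) + (+ 2 * x * t + t * t * P) * P
    split = solve-∀
    collect : ∀ e x t P → e * P + (+ 2 * x * t + t * t * P) * P ≡ (e + + 2 * x * t + t * t * P) * P
    collect = solve-∀
    expand : (x + t * P) * (x + t * P) - m ≡ (e + + 2 * x * t + t * t * P) * P
    expand = trans (split x t P m) (trans (cong (_+ (+ 2 * x * t + t * t * P) * P) x²-m≡eP) (collect e x t P))

sumOver-quads : ∀ n {w : Quad n → ℤ} {F : ℤ → ℤ → ℤ → ℤ → ℤ} → (∀ i j k l → w (i , j , k , l) ≡ F (toℤ i) (toℤ j) (toℤ k) (toℤ l)) →
  sumOver w (quads n) ≡ ∑⁴ n F
sumOver-quads n {w} e =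
  trans (sumOver-concatMap w _ (allFin n)) (sumOver-allFin λ i →
  trans (sumOver-concatMap w _ (allFin n)) (sumOver-allFin λ j →
  trans (sumOver-concatMap w _ (allFin n)) (sumOver-allFin λ k →
  trans (sumOver-map w _ (allFin n)) (sumOver-allFin λ l → e i j k l))))

-- Gaussian integers and characters modulo a prime power

gaussian-≡ : ∀ {z w : ℤ[i]} → re z ≡ re w → im z ≡ im w → z ≡ w
gaussian-≡ = cong₂ mkℤ[i]

*ᵍ-identityʳ : ∀ z → z *ᵍ 1ᵍ ≡ z
*ᵍ-identityʳ (mkℤ[i] a b) = cong₂ mkℤ[i] (real a b) (imag a b)
  where
  real : ∀ a b → a * + 1 - b * + 0 ≡ a
  real = solve-∀
  imag : ∀ a b → a * + 0 + b * + 1 ≡ b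
  imag = solve-∀

*ᵍ-interchange : ∀ z w u v → (z *ᵍ w) *ᵍ (u *ᵍ v) ≡ (z *ᵍ u) *ᵍ (w *ᵍ v)
*ᵍ-interchange (mkℤ[i] a b) (mkℤ[i] c d) (mkℤ[i] e f) (mkℤ[i] g h) = cong₂ mkℤ[i] (real a b c d e f g h) (imag a b c d e f g h)
  where
  real : ∀ a b c d e f g h → (a * c - b * d) * (e * g - f * h) - (a * d + b * c) * (e * h + f * g) ≡
                             (a * e - b * f) * (c * g - d * h) - (a * f + b * e) * (c * h + d * g)
  real = solve-∀
  imag : ∀ a b c d e f g h → (a * c - b * d) * (e * h + f * g) + (a * d + b * c) * (e * g - f * h) ≡
                             (a * e - b * f) * (c * h + d * g) + (a * f + b * e) * (c * g - d * h)
  imag = solve-∀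

^ᵍ-2 : ∀ z → z ^ᵍ 2 ≡ z *ᵍ z
^ᵍ-2 z = cong (z *ᵍ_) (*ᵍ-identityʳ z)

^ᵍ-4 : ∀ z → z ^ᵍ 4 ≡ (z *ᵍ z) *ᵍ (z *ᵍ z)
^ᵍ-4 z@(mkℤ[i] a b) = trans (cong (λ w → z *ᵍ (z *ᵍ w)) (^ᵍ-2 z)) (cong₂ mkℤ[i] (real a b) (imag a b))
  where
  real : ∀ a b → a * (a * (a * a - b * b) - b * (a * b + b * a)) - b * (a * (a * b + b * a) + b * (a * a - b * b)) ≡
                 (a * a - b * b) * (a * a - b * b) - (a * b + b * a) * (a * b + b * a)
  real = solve-∀
  imag : ∀ a b → a * (a * (a * b + b * a) + b * (a * a - b * b)) + b * (a * (a * a - b * b) - b * (a * b + b * a)) ≡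
                 (a * a - b * b) * (a * b + b * a) + (a * b + b * a) * (a * a - b * b)
  imag = solve-∀

-i²≢1 : ∀ i → - (i * i) ≢ + 1
-i²≢1 (+ zero)     ()
-i²≢1 ℤ.+[1+ n ]   ()
-i²≢1 ℤ.-[1+ n ]   ()

i²≡1 : ∀ i → i * i ≡ + 1 → i ≡ + 1 ⊎ i ≡ - + 1
i²≡1 i e with ℕP.m*n≡1⇒m≡1 ∣ i ∣ ∣ i ∣ (trans (sym (ℤP.abs-* i i)) (cong ∣_∣ e)) | ℤP.+∣i∣≡i⊎+∣i∣≡-i i
... | a | inj₁ f = inj₁ (trans (sym f) (cong +_ a))
... | a | inj₂ f = inj₂ (trans (sym (ℤP.neg-involutive i)) (cong -_ (trans (sym f) (cong +_ a))))

-- The hypothesis says that (a + b i)² has imaginary part 2 a b = 0.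
real-or-imaginary : ∀ a b → a * b + b * a ≡ + 0 → a ≡ + 0 ⊎ b ≡ + 0
real-or-imaginary a b e = ℤP.i*j≡0⇒i≡0∨j≡0 a (i≡-i⇒i≡0 (begin
  a * b                        ≡⟨ lemma a b ⟩
  (a * b + b * a) + - (a * b)  ≡⟨ cong (_+ - (a * b)) e ⟩
  + 0 + - (a * b)              ≡⟨ ℤP.+-identityˡ (- (a * b)) ⟩
  - (a * b)                    ∎))
  where
  lemma : ∀ a b → a * b ≡ (a * b + b * a) + - (a * b)
  lemma = solve-∀

square-roots-of-1 : ∀ z → z *ᵍ z ≡ 1ᵍ → z ≡ 1ᵍ ⊎ z ≡ fromℤ (- + 1)
square-roots-of-1 (mkℤ[i] a b) e with real-or-imaginary a b (cong im e)
... | inj₁ refl = ⊥-elim (-i²≢1 b (trans (sym (ℤP.+-identityˡ (- (b * b)))) (cong re e)))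
... | inj₂ refl with i²≡1 a (trans (sym (ℤP.+-identityʳ (a * a))) (cong re e))
...   | inj₁ f = inj₁ (cong fromℤ f)
...   | inj₂ f = inj₂ (cong fromℤ f)

-- Meant for the values of ψ at nonsquares, of which only the vanishing real part matters.
square-roots-of--1 : ∀ z → z *ᵍ z ≡ fromℤ (- + 1) → re z ≡ + 0
square-roots-of--1 (mkℤ[i] a b) e with real-or-imaginary a b (cong im e)
... | inj₁ a≡0 = a≡0
... | inj₂ refl = ⊥-elim (-i²≢1 a (cong -_ (trans (sym (ℤP.+-identityʳ (a * a))) (cong re e))))

re-sumᵍ : ∀ n {f F} → (∀ i → re (f i) ≡ F (+ i)) → re (sumᵍ n f) ≡ ∑ n F
re-sumᵍ n {f} e = trans (go (upTo n)) (sumOver-applyUpTo n (λ i → i) e)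
  where
  go : ∀ xs → re (foldr (λ x acc → f x +ᵍ acc) 0ᵍ xs) ≡ sumOver (re ∘ f) xs
  go []       = refl
  go (x ∷ xs) = cong (ℤ._+_ (re (f x))) (go xs)

im-sumᵍ : ∀ n {f F} → (∀ i → im (f i) ≡ F (+ i)) → im (sumᵍ n f) ≡ ∑ n F
im-sumᵍ n {f} e = trans (go (upTo n)) (sumOver-applyUpTo n (λ i → i) e)
  where
  go : ∀ xs → im (foldr (λ x acc → f x +ᵍ acc) 0ᵍ xs) ≡ sumOver (im ∘ f) xs
  go []       = refl
  go (x ∷ xs) = cong (ℤ._+_ (im (f x))) (go xs)

-- The imaginary parts of z² and its conjugate cancel, so the claim is an identity between integers.
-- Of the four factors q, two go into U; the other two become V in the first summand, and one q in
-- each factor z of the squares.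
gaussian-product : ∀ q p p′ P A B k U V z → k ≡ q * (q * (q * (q * (p * (p′ * (P + + 2 * (A * A - B * B))))))) →
  U ≡ q * q * p → V ≡ q * q → z ≡ mkℤ[i] (q * A) (q * B) →
  fromℤ k ≡ fromℤ (U * p′) *ᵍ (fromℤ (V * P) +ᵍ z *ᵍ z +ᵍ conj z *ᵍ conj z)
gaussian-product q p p′ P A B _ _ _ _ refl refl refl refl = cong₂ mkℤ[i] (real q p p′ P A B) (imag (q * q * p * p′) (q * q * P) (q * A) (q * B))
  where
  real : ∀ q p p′ P A B → q * (q * (q * (q * (p * (p′ * (P + + 2 * (A * A - B * B))))))) ≡
    q * q * p * p′ * (q * q * P + ((q * A) * (q * A) - (q * B) * (q * B)) + ((q * A) * (q * A) - - (q * B) * - (q * B)))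
      - + 0 * (+ 0 + ((q * A) * (q * B) + (q * B) * (q * A)) + ((q * A) * - (q * B) + - (q * B) * (q * A)))
  real = solve-∀
  imag : ∀ U V a b → + 0 ≡ U * (+ 0 + (a * b + b * a) + (a * - b + - b * a)) + + 0 * (V + (a * a - b * b) + (a * a - - b * - b))
  imag = solve-∀

module PrimePower (p β : ℕ) (pr : Prime p) (p∤2 : ¬ + p ∣ + 2) where

  open PrimeModulus p pr

  n : ℕ
  n = p ^ suc β

  unit⇒∤ : ∀ {a} → IsUnitMod n a → ¬ + p ∣ a
  unit⇒∤ {a} co p∣a = case subst Prime (co (∣⇒∣ᵤ p∣a , ℕD.m∣m*n (p ^ β))) pr of λ ()

  ∤⇒unit : ∀ {a} → ¬ + p ∣ a → IsUnitMod n a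
  ∤⇒unit p∤a = prime-coprime-^ (suc β) pr (p∤a ∘ ∣ᵤ⇒∣)

  n∣⇒p∣ : ∀ {a} → + n ∣ a → + p ∣ a
  n∣⇒p∣ = ∣ℤ.∣-trans (divides (+ (p ^ β)) (trans (ℤP.pos-* p (p ^ β)) (ℤP.*-comm (+ p) (+ (p ^ β)))))

  -- Hensel lifts the root, and reduction to a residue changes it by a multiple of n. It is a unit
  -- because its square is m modulo p.
  lift-root : ∀ {m} y → ¬ + p ∣ m → + p ∣ y * y - m →
              ∃ λ (r : Fin n) → Coprime (toℕ r) n × (+ n ∣ m - toℤ r * toℤ r)
  lift-root {m} y p∤m p∣y²-m with hensel-sqrt pr p∤2 {m} {y} (square-unit y p∤m p∣y²-m) p∣y²-m β
  ... | x , _ , n∣x²-m with Congruence.residue n {{ℕP.m^n≢0 p (suc β) {{prime⇒nonZero pr}}}} x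
  ...   | r , Congruence.mod n∣x-r = r , ∤⇒unit {toℤ r} p∤r , n∣m-r²
    where
    combine : ∀ m x r → m - r * r ≡ - + 1 * (x * x - m) + (x + r) * (x - r)
    combine = solve-∀
    n∣m-r² : + n ∣ m - toℤ r * toℤ r
    n∣m-r² = ∣-lin (- + 1) (x + toℤ r) n∣x²-m n∣x-r (combine m x (toℤ r))
    recover : ∀ m r → m ≡ r * r + + 1 * (m - r * r)
    recover = solve-∀
    p∤r : ¬ + p ∣ toℤ r
    p∤r d = p∤m (∣-lin (toℤ r) (+ 1) d (n∣⇒p∣ n∣m-r²) (recover m (toℤ r)))

  module _ (D : DirichletCharacter n) (quartic : ∀ {a} → ¬ + p ∣ a → (χ D a *ᵍ χ D a) *ᵍ (χ D a *ᵍ χ D a) ≡ 1ᵍ) where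

    character-per-n : ∀ {a b} → + n ∣ a - b → χ D a ≡ χ D b
    character-per-n {a} {b} (divides q eq) = go q eq
      where
      zero-shift : ∀ a n → a + + 0 * n ≡ a
      zero-shift = solve-∀
      suc-shift : ∀ a k n → a + (+ 1 + k) * n ≡ a + k * n + n
      suc-shift = solve-∀
      shift : ∀ a k → χ D (a + + k * + n) ≡ χ D a
      shift a zero    = cong (χ D) (zero-shift a (+ n))
      shift a (suc k) = trans (cong (χ D) (suc-shift a (+ k) (+ n))) (trans (periodic D _) (shift a k))
      recover : ∀ a b → a ≡ b + (a - b)
      recover = solve-∀
      recover′ : ∀ a b → b ≡ a + - (a - b)
      recover′ = solve-∀
      go : ∀ q → a - b ≡ q * + n → χ D a ≡ χ D b
      go (+ k)      e = trans (cong (χ D) (trans (recover a b) (cong (ℤ._+_ b) e))) (shift b k)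
      go ℤ.-[1+ k ] e = sym (trans (cong (χ D) (trans (recover′ a b) (cong (ℤ._+_ a) (trans (cong -_ e) (ℤP.neg-distribˡ-* ℤ.-[1+ k ] (+ n)))))) (shift a (suc k)))

    -- A unit u ≡ 1 mod p is a fourth power mod n, hence has value 1.
    character-per-p : ∀ {a b} → a ≈ b → χ D a ≡ χ D b
    character-per-p {a} {b} a≈b = case + p ∣? a of λ where
        (yes p∣a) → trans (vanish D a (λ co → unit⇒∤ {a} co p∣a)) (sym (vanish D b (λ co → unit⇒∤ {b} co (≈-∣ a≈b p∣a))))
        (no p∤a) → unit p∤a
      where
      unit : ¬ + p ∣ a → χ D a ≡ χ D b
      unit p∤a with coprime⇒invertible a (∤⇒unit p∤a)
      -- With a′ the inverse of a, the number b a′ is 1 modulo p, hence a square x² modulo n with x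
      -- ≡ 1 modulo p; then x is itself a square y² for the same reason.
      ... | a′ , aa′ with hensel-sqrt pr p∤2 {b * a′} {+ 1} ∤1
                        (∣-lin (- + 1) (a′) (n∣⇒p∣ aa′) (≈⇒∣ a≈b) (start a a′ b)) β
        where
        start : ∀ a a′ b → + 1 * + 1 - b * a′ ≡ - + 1 * (a * a′ - + 1) + a′ * (a - b)
        start = solve-∀
      ...   | x , p∣x-1 , x² with hensel-sqrt pr p∤2 {x} {+ 1} ∤1 (∣-mul (- + 1) p∣x-1 (flip x)) β
        where
        flip : ∀ x → + 1 * + 1 - x ≡ - + 1 * (x - + 1)
        flip = solve-∀
      ...     | y , p∣y-1 , y² = sym (begin
        χ D b                                                 ≡⟨ character-per-n (∣-lin (- b) (- a) aa′ x² (close a a′ b x)) ⟩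
        χ D (a * (x * x))                                     ≡⟨ trans (multiplicative D a (x * x)) (cong (χ D a *ᵍ_) (multiplicative D x x)) ⟩
        χ D a *ᵍ (χ D x *ᵍ χ D x)                             ≡⟨ cong (λ z → χ D a *ᵍ (z *ᵍ z)) (trans (sym (character-per-n y²)) (multiplicative D y y)) ⟩
        χ D a *ᵍ ((χ D y *ᵍ χ D y) *ᵍ (χ D y *ᵍ χ D y))       ≡⟨ cong (χ D a *ᵍ_) (quartic p∤y) ⟩
        χ D a *ᵍ 1ᵍ                                           ≡⟨ *ᵍ-identityʳ (χ D a) ⟩
        χ D a                                                 ∎)
        where
        close : ∀ a a′ b x → b - a * (x * x) ≡ - b * (a * a′ - + 1) + - a * (x * x - b * a′)
        close = solve-∀
        one : ∀ y → + 1 ≡ + 1 * y + - + 1 * (y - + 1)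
        one = solve-∀
        p∤y : ¬ + p ∣ y
        p∤y d = ∤1 (∣-lin (+ 1) (- + 1) d p∣y-1 (one y))

  module _ (f : ℤ → ℤ[i]) (f-per : ∀ {a b} → a ≈ b → f a ≡ f b) (f-* : ∀ a b → f (a * b) ≡ f a *ᵍ f b)
    (f-∣ : ∀ {a} → + p ∣ a → f a ≡ 0ᵍ) (f² : ∀ {a} → ¬ + p ∣ a → f a *ᵍ f a ≡ 1ᵍ) (f≢1 : ∃ λ a → (¬ + p ∣ a) × (f a ≢ 1ᵍ)) where

    f-real : ∀ a → im (f a) ≡ + 0
    f-real a = case + p ∣? a of λ where
      (yes p∣a) → cong im (f-∣ p∣a)
      (no p∤a)  → [ cong im , cong im ]′ (square-roots-of-1 (f a) (f² p∤a))

    -- Values at units are square roots of 1 in ℤ[i], hence ±1. Passing to real parts therefore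
    -- loses nothing and stays multiplicative, and a unit value other than 1 can only be -1.
    quadraticCharacter : QuadraticCharacter
    quadraticCharacter = record
      { η          = re ∘ f
      ; η-per      = λ e → cong re (f-per e)
      ; η-*        = λ a b → trans (cong re (f-* a b)) (trans (cong (λ z → re (f a) * re (f b) - im (f a) * z) (f-real b)) (lemma (re (f a) * re (f b)) (im (f a))))
      ; η-∣        = λ d → cong re (f-∣ d)
      ; η-unit     = λ {a} p∤a → [ inj₁ ∘ cong re , inj₂ ∘ cong re ]′ (square-roots-of-1 (f a) (f² p∤a))
      ; nonresidue = case f≢1 of λ where
          (a , p∤a , fa≢1) → a , [ ⊥-elim ∘ fa≢1 , cong re ]′ (square-roots-of-1 (f a) (f² p∤a))
      }
      where
      lemma : ∀ x y → x - y * + 0 ≡ x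
      lemma = solve-∀

-- The count of K₄

module Main (p β : ℕ) (pr : Prime p) (p∤2 : ¬ + p ∣ + 2)
  (c ψ : DirichletCharacter (p ^ suc β)) (order-c : HasOrder c 2) (order-ψ : HasOrder ψ 4) where

  open PrimeModulus p pr
  open PrimePower p β pr p∤2

  private
    instance
      p≢0 : ℕ.NonZero p
      p≢0 = prime⇒nonZero pr

      n≢0 : ℕ.NonZero n
      n≢0 = ℕP.m^n≢0 p (suc β)

    q : ℕ
    q = p ^ β

    c² : ∀ {a} → ¬ + p ∣ a → χ c a *ᵍ χ c a ≡ 1ᵍ
    c² {a} p∤a = trans (sym (^ᵍ-2 (χ c a))) (proj₁ order-c a (∤⇒unit p∤a))

    c-per : ∀ {a b} → a ≈ b → χ c a ≡ χ c b
    c-per = character-per-p c (λ p∤a → cong₂ _*ᵍ_ (c² p∤a) (c² p∤a))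

    ψ⁴ : ∀ {a} → ¬ + p ∣ a → (χ ψ a *ᵍ χ ψ a) *ᵍ (χ ψ a *ᵍ χ ψ a) ≡ 1ᵍ
    ψ⁴ {a} p∤a = trans (sym (^ᵍ-4 (χ ψ a))) (proj₁ order-ψ a (∤⇒unit p∤a))

    ψ-per : ∀ {a b} → a ≈ b → χ ψ a ≡ χ ψ b
    ψ-per = character-per-p ψ ψ⁴

    vanishes : (D : DirichletCharacter n) → ∀ {a} → + p ∣ a → χ D a ≡ 0ᵍ
    vanishes D {a} p∣a = vanish D a (λ co → unit⇒∤ {a} co p∣a)

    ψ² : ℤ → ℤ[i]
    ψ² a = χ ψ a *ᵍ χ ψ a

    ψ²-per : ∀ {a b} → a ≈ b → ψ² a ≡ ψ² b
    ψ²-per e = cong₂ _*ᵍ_ (ψ-per e) (ψ-per e)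

    ψ²-* : ∀ a b → ψ² (a * b) ≡ ψ² a *ᵍ ψ² b
    ψ²-* a b = trans (cong₂ _*ᵍ_ (multiplicative ψ a b) (multiplicative ψ a b)) (*ᵍ-interchange (χ ψ a) (χ ψ b) (χ ψ a) (χ ψ b))

    ψ²-∣ : ∀ {a} → + p ∣ a → ψ² a ≡ 0ᵍ
    ψ²-∣ d = cong₂ _*ᵍ_ (vanishes ψ d) (vanishes ψ d)

    c≢1 : ∃ λ a → (¬ + p ∣ a) × (χ c a ≢ 1ᵍ)
    c≢1 with proj₂ order-c 1 (ℕ.s≤s ℕ.z≤n) (ℕ.s≤s (ℕ.s≤s ℕ.z≤n))
    ... | a , co , ca≢1 = a , unit⇒∤ {a} co , λ e → ca≢1 (trans (*ᵍ-identityʳ (χ c a)) e)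

    -- Minimality of the order 4, taken at the exponent 2, is what makes ψ² nontrivial.
    ψ²≢1 : ∃ λ a → (¬ + p ∣ a) × (ψ² a ≢ 1ᵍ)
    ψ²≢1 with proj₂ order-ψ 2 (ℕ.s≤s ℕ.z≤n) (ℕ.s≤s (ℕ.s≤s (ℕ.s≤s ℕ.z≤n)))
    ... | a , co , ψ²a≢1 = a , unit⇒∤ {a} co , λ e → ψ²a≢1 (trans (^ᵍ-2 (χ ψ a)) e)

    C C′ : QuadraticCharacter
    C  = quadraticCharacter (χ c) c-per (multiplicative c) (vanishes c) c² c≢1
    C′ = quadraticCharacter ψ² ψ²-per ψ²-* ψ²-∣ ψ⁴ ψ²≢1

  open QuadraticCharacter C

  private
    c≡ψ² : ∀ a → χ c a ≡ ψ² a
    c≡ψ² a = gaussian-≡ (quadratic-unique p∤2 C C′ a)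
      (trans (f-real (χ c) c-per (multiplicative c) (vanishes c) c² c≢1 a) (sym (f-real ψ² ψ²-per ψ²-* ψ²-∣ ψ⁴ ψ²≢1 a)))

    -- As η is the square of a character, η(-1) = ψ(-1)² = ψ(1). This makes every difference
    -- reversible under η.
    η-1 : η (- + 1) ≡ + 1
    η-1 = trans (cong re (c≡ψ² (- + 1))) (cong re (trans (sym (multiplicative ψ (- + 1) (- + 1))) (at-one ψ)))

    η-even : ∀ a → η (- a) ≡ η a
    η-even a = trans (cong η (sym (ℤP.-1*i≡-i a))) (trans (η-* (- + 1) a) (trans (cong (_* η a) η-1) (ℤP.*-identityˡ (η a))))

  open QuadraticSums p pr C η-even
  open CliqueSum p pr C η-even
  open JacobiSquare p pr C η-even p∤2

  private
    ρ σ : ℤ → ℤ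
    ρ u = re (χ ψ u)
    σ u = im (χ ψ u)

    -- Where η u = -1, the value ψ(u) squares to -1 and is purely imaginary, so both sides are 0.
    ηρ : ∀ u → η u * ρ u ≡ ρ u
    ηρ u = case + p ∣? u of λ where
          (yes p∣u) → trans (cong (η u *_) (ρ-∣ p∣u)) (trans (ℤP.*-zeroʳ (η u)) (sym (ρ-∣ p∣u)))
          (no p∤u)  → case square-roots-of-1 (ψ² u) (ψ⁴ p∤u) of λ where
            (inj₁ e) → trans (cong (_* ρ u) (cong re (trans (c≡ψ² u) e))) (ℤP.*-identityˡ (ρ u))
            (inj₂ e) → trans (cong (η u *_) (square-roots-of--1 (χ ψ u) e)) (trans (ℤP.*-zeroʳ (η u)) (sym (square-roots-of--1 (χ ψ u) e)))
      where
      ρ-∣ : + p ∣ u → ρ u ≡ + 0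
      ρ-∣ d = cong re (vanishes ψ d)

    -- Each root v of u has η v = ψ(v²) = ψ(u). There are 1 + η u of them, and `ηρ` turns that
    -- factor into 2.
    square-sum : ∀ u → ∑[ v < p ] (δ (v * v - u) * η v) ≡ + 2 * ρ u
    square-sum u = begin
      ∑[ v < p ] (δ (v * v - u) * η v)   ≡⟨ ∑-cong (λ v → δ-on (η-root v)) ⟩
      ∑[ v < p ] (δ (v * v - u) * ρ u)   ≡⟨ ∑-*ʳ (ρ u) (λ v → δ (v * v - u)) ⟩
      roots u * ρ u                      ≡⟨ cong (_* ρ u) (roots≡1+η p∤2 C u) ⟩
      (+ 1 + η u) * ρ u                  ≡⟨ expand (η u) (ρ u) ⟩
      ρ u + η u * ρ u                    ≡⟨ cong (ℤ._+_ (ρ u)) (ηρ u) ⟩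
      ρ u + ρ u                          ≡⟨ double (ρ u) ⟩
      + 2 * ρ u                          ∎
      where
      expand : ∀ a b → (+ 1 + a) * b ≡ b + a * b
      expand = solve-∀
      double : ∀ a → a + a ≡ + 2 * a
      double = solve-∀
      η-root : ∀ v → + p ∣ v * v - u → η v ≡ ρ u
      η-root v d = cong re (trans (c≡ψ² v) (trans (sym (multiplicative ψ v v)) (ψ-per (mod d))))

    A B : ℤ
    A = ∑[ x < p ] (ρ x * η (+ 1 - x))
    B = ∑[ x < p ] (σ x * η (+ 1 - x))

    product : ∀ f h → (∑ p f) * (∑ p h) ≡ ∑[ x < p ] ∑[ y < p ] (f x * h y)
    product f h = sym (trans (∑-cong (λ x → ∑-*ˡ (f x) h)) (∑-*ʳ (∑ p h) f))

    -- A + B i is the Jacobi sum taken modulo p. In the expanded products Re ψ(x) Re ψ(y) - Im ψ(x)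
    -- Im ψ(y) is Re ψ(xy), to which `jacobi-square` applies.
    2[A²-B²]≡X : + 2 * (A * A - B * B) ≡ X
    2[A²-B²]≡X = begin
      + 2 * (A * A - B * B)
        ≡⟨ cong (ℤ._*_ (+ 2)) (trans (cong₂ _-_ (product _ _) (product _ _)) (trans (sym (∑-distrib-minus (λ x → ∑[ y < p ] (a x * a y)) (λ x → ∑[ y < p ] (b x * b y))))
             (∑-cong (λ x → sym (∑-distrib-minus (λ y → a x * a y) (λ y → b x * b y)))))) ⟩
      + 2 * (∑[ x < p ] ∑[ y < p ] (a x * a y - b x * b y))
        ≡⟨ sym (trans (∑-cong (λ x → ∑-*ˡ (+ 2) (λ y → a x * a y - b x * b y))) (∑-*ˡ (+ 2) _)) ⟩
      ∑[ x < p ] ∑[ y < p ] (+ 2 * (a x * a y - b x * b y))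
        ≡⟨ ∑-cong (λ x → ∑-cong (λ y → trans (collect (ρ x) (η (+ 1 - x)) (ρ y) (η (+ 1 - y)) (σ x) (σ y))
             (cong (λ z → + 2 * z * (η (+ 1 - x) * η (+ 1 - y))) (sym (cong re (multiplicative ψ x y)))))) ⟩
      ∑[ x < p ] ∑[ y < p ] (+ 2 * ρ (x * y) * (η (+ 1 - x) * η (+ 1 - y))) ≡⟨ jacobi-square ρ square-sum ⟩
      X ∎
      where
      a b : ℤ → ℤ
      a x = ρ x * η (+ 1 - x)
      b x = σ x * η (+ 1 - x)
      collect : ∀ r h r′ h′ s s′ → + 2 * ((r * h) * (r′ * h′) - (s * h) * (s′ * h′)) ≡ + 2 * (r * r′ - s * s′) * (h * h′)
      collect = solve-∀

    ∑-n : ∀ {f} → Per f → ∑ n f ≡ + q * ∑ p f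
    ∑-n {f} per = trans (cong (λ m → ∑ m f) (ℕP.*-comm p q)) (∑-blocks q per)

    c-real : ∀ a → im (χ c a) ≡ + 0
    c-real = f-real (χ c) c-per (multiplicative c) (vanishes c) c² c≢1

    1-per : ∀ {a b} → a ≈ b → η (+ 1 - a) ≡ η (+ 1 - b)
    1-per e = η-per (-‿≈ (≈-refl {+ 1}) e)

    jacobi : Jacobi ψ c ≡ mkℤ[i] (+ q * A) (+ q * B)
    jacobi = gaussian-≡
        (trans (re-sumᵍ n {λ x → χ ψ (+ x) *ᵍ χ c (+ 1 - + x)} (λ i → trans (cong (λ z → ρ (+ i) * η (+ 1 - + i) - σ (+ i) * z) (c-real (+ 1 - + i))) (real (ρ (+ i) * η (+ 1 - + i)) (σ (+ i)))))
               (∑-n (λ e → cong₂ _*_ (cong re (ψ-per e)) (1-per e))))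
        (trans (im-sumᵍ n {λ x → χ ψ (+ x) *ᵍ χ c (+ 1 - + x)} (λ i → trans (cong (λ z → ρ (+ i) * z + σ (+ i) * η (+ 1 - + i)) (c-real (+ 1 - + i))) (imag (ρ (+ i)) (σ (+ i) * η (+ 1 - + i)))))
               (∑-n (λ e → cong₂ _*_ (cong im (ψ-per e)) (1-per e))))
      where
      real : ∀ a b → a - b * + 0 ≡ a
      real = solve-∀
      imag : ∀ a b → a * + 0 + b ≡ b
      imag = solve-∀

    adj⇒η : ∀ i j → Adj n i j → η (toℤ i - toℤ j) ≡ + 1
    adj⇒η i j (_ , x , co , d) = begin
      η (toℤ i - toℤ j)       ≡⟨ η-per (mod (n∣⇒p∣ (∣ᵤ⇒∣ d))) ⟩
      η (toℤ x * toℤ x)       ≡⟨ η-* (toℤ x) (toℤ x) ⟩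
      η (toℤ x) * η (toℤ x)   ≡⟨ η²-unit (unit⇒∤ {toℤ x} co) ⟩
      + 1                     ∎

    root⇒adj : ∀ i j → i ≢ j → (∃ λ (r : Fin n) → Coprime (toℕ r) n × (+ n ∣ toℤ i - toℤ j - toℤ r * toℤ r)) → Adj n i j
    root⇒adj i j i≢j (r , co , d) = i≢j , r , co , ∣⇒∣ᵤ d

    -- The value 1 keeps p from dividing the difference, hence i ≠ j, and it makes the root count 2;
    -- a root modulo p is then lifted modulo n.
    η⇒adj : ∀ i j → η (toℤ i - toℤ j) ≡ + 1 → Adj n i j
    η⇒adj i j ηm≡1 = root⇒adj i j i≢j (lift-root (+ toℕ (proj₁ y)) p∤m (proj₂ y))
      where
      y : ∃ λ (y : Fin p) → + p ∣ + toℕ y * + toℕ y - (toℤ i - toℤ j)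
      y = square-root p∤2 C (toℤ i - toℤ j) ηm≡1
      p∤m : ¬ + p ∣ toℤ i - toℤ j
      p∤m = residue-∤ ηm≡1
      i≢j : i ≢ j
      i≢j i≡j = p∤m (divides (+ 0) (trans (cong (λ k → toℤ k - toℤ j) i≡j) (ℤP.+-inverseʳ (toℤ j))))

    -- Distinct vertices that agree modulo p are not adjacent, as their difference is no unit; the δ
    -- in `g` cancels the 1 exactly there.
    adj-weight : ∀ i j (i~j? : Dec (Adj n i j)) → + 2 * ind i~j? ≡ g (toℤ i - toℤ j)
    adj-weight i j (yes a) = trans (cong (ℤ._*_ (+ 2)) (ind-yes (yes a) a)) (sym (cong₂ (λ u v → + 1 - u + v) (δ-no (residue-∤ (adj⇒η i j a))) (adj⇒η i j a)))
    adj-weight i j (no ¬a) = trans (cong (ℤ._*_ (+ 2)) (ind-no (no ¬a) ¬a)) (case + p ∣? (toℤ i - toℤ j) of λ where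
      (yes d) → sym (cong₂ (λ u v → + 1 - u + v) (δ-yes d) (η-∣ d))
      (no ¬d) → case η-unit ¬d of λ where
        (inj₁ e) → ⊥-elim (¬a (η⇒adj i j e))
        (inj₂ e) → sym (cong₂ (λ u v → + 1 - u + v) (δ-no ¬d) e))

    F : ℤ → ℤ → ℤ → ℤ → ℤ
    F a b c d = L a b * L b c * L c d * clique a b c d

    order-weight : ∀ (i j : Fin n) → ind (i Fin.<? j) ≡ L (toℤ i) (toℤ j)
    order-weight i j = L-ind (i Fin.<? j) (λ i<j → ℤ.+<+ i<j) ℤP.drop‿+<+

    K₄-weight : ∀ i j k l → weighted (+ 64) (isK4? n (i , j , k , l)) ≡ F (toℤ i) (toℤ j) (toℤ k) (toℤ l)
    K₄-weight i j k l = ind-ordered-clique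
      (i Fin.<? j) (j Fin.<? k) (k Fin.<? l) (adj? n i j) (adj? n i k) (adj? n i l) (adj? n j k) (adj? n j l) (adj? n k l)
      (L (toℤ i) (toℤ j)) (L (toℤ j) (toℤ k)) (L (toℤ k) (toℤ l))
      (g (toℤ i - toℤ j)) (g (toℤ i - toℤ k)) (g (toℤ i - toℤ l)) (g (toℤ j - toℤ k)) (g (toℤ j - toℤ l)) (g (toℤ k - toℤ l))
      (order-weight i j) (order-weight j k) (order-weight k l)
      (adj-weight i j (adj? n i j)) (adj-weight i k (adj? n i k)) (adj-weight i l (adj? n i l))
      (adj-weight j k (adj? n j k)) (adj-weight j l (adj? n j l)) (adj-weight k l (adj? n k l))

    K₄-sum : + 64 * + K₄ n ≡ ∑⁴ n F
    K₄-sum = trans (weighted-length-filter (+ 64) (isK4? n) (quads n) {K₄ n} refl) (sumOver-quads n {weighted (+ 64) ∘ isK4? n} {F} K₄-weight)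

    g-0 : ∀ b → g (b - b) ≡ + 0
    g-0 b = trans (g-per (≈-reflexive {b - b} {+ 0} (ℤP.+-inverseʳ b))) (cong₂ (λ u v → + 1 - u + v) (δ-yes p∣0) (η-∣ p∣0))
      where
      p∣0 : + p ∣ + 0
      p∣0 = divides (+ 0) refl

    clique₁₂ : ∀ a b c d → clique b a c d ≡ clique a b c d
    clique₁₂ a b c d = trans (cong (λ z → z * g (b - c) * g (b - d) * (g (a - c) * g (a - d) * g (c - d))) (g-swap b a))
      (rearrange (g (a - b)) (g (b - c)) (g (b - d)) (g (a - c)) (g (a - d)) (g (c - d)))
      where
      rearrange : ∀ ab bc bd ac ad cd → ab * bc * bd * (ac * ad * cd) ≡ ab * ac * ad * (bc * bd * cd)
      rearrange = solve-∀

    clique₂₃ : ∀ a b c d → clique a c b d ≡ clique a b c d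
    clique₂₃ a b c d = trans (cong (λ z → g (a - c) * g (a - b) * g (a - d) * (z * g (c - d) * g (b - d))) (g-swap c b))
      (rearrange (g (a - b)) (g (b - c)) (g (b - d)) (g (a - c)) (g (a - d)) (g (c - d)))
      where
      rearrange : ∀ ab bc bd ac ad cd → ac * ab * ad * (bc * cd * bd) ≡ ab * ac * ad * (bc * bd * cd)
      rearrange = solve-∀

    clique₃₄ : ∀ a b c d → clique a b d c ≡ clique a b c d
    clique₃₄ a b c d = trans (cong (λ z → g (a - b) * g (a - d) * g (a - c) * (g (b - d) * g (b - c) * z)) (g-swap d c))
      (rearrange (g (a - b)) (g (b - c)) (g (b - d)) (g (a - c)) (g (a - d)) (g (c - d)))
      where
      rearrange : ∀ ab bc bd ac ad cd → ab * ad * ac * (bd * bc * cd) ≡ ab * ac * ad * (bc * bd * cd)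
      rearrange = solve-∀

    clique-≡ : ∀ b c d → clique b b c d ≡ + 0
    clique-≡ b c d = cong (λ z → z * g (b - c) * g (b - d) * (g (b - c) * g (b - d) * g (c - d))) (g-0 b)

    ∑⁴-n : ∑⁴ n clique ≡ + q * (+ q * (+ q * (+ q * ∑⁴ p clique)))
    ∑⁴-n = begin
      ∑[ a < n ] ∑[ b < n ] ∑[ c < n ] ∑[ d < n ] clique a b c d
        ≡⟨ ∑-cong (λ a → ∑-cong (λ b → ∑-cong (λ c → ∑-n (clique-per₄ a b c)))) ⟩
      ∑[ a < n ] ∑[ b < n ] ∑[ c < n ] (+ q * (∑[ d < p ] clique a b c d))
        ≡⟨ ∑-cong (λ a → ∑-cong (λ b → trans (∑-*ˡ (+ q) _) (cong (ℤ._*_ (+ q)) (∑-n (λ e → ∑-cong (λ d → clique-per₃ a b d e)))))) ⟩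
      ∑[ a < n ] ∑[ b < n ] (+ q * (+ q * (∑[ c < p ] ∑[ d < p ] clique a b c d)))
        ≡⟨ ∑-cong (λ a → trans (trans (∑-*ˡ (+ q) _) (cong (ℤ._*_ (+ q)) (∑-*ˡ (+ q) _)))
             (cong (λ z → + q * (+ q * z)) (∑-n (λ e → ∑-cong (λ c → ∑-cong (λ d → clique-per₂ a c d e)))))) ⟩
      ∑[ a < n ] (+ q * (+ q * (+ q * (∑[ b < p ] ∑[ c < p ] ∑[ d < p ] clique a b c d))))
        ≡⟨ trans (trans (∑-*ˡ (+ q) _) (cong (ℤ._*_ (+ q)) (trans (∑-*ˡ (+ q) _) (cong (ℤ._*_ (+ q)) (∑-*ˡ (+ q) _)))))
             (cong (λ z → + q * (+ q * (+ q * z))) (∑-n (λ e → ∑-cong (λ b → ∑-cong (λ c → ∑-cong (λ d → clique-per₁ b c d e)))))) ⟩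
      + q * (+ q * (+ q * (+ q * ∑⁴ p clique))) ∎

    P : ℤ
    P = (+ p - + 9) * (+ p - + 9) - + 2 * + p

    K₄-count : + 1536 * + K₄ n ≡ + q * (+ q * (+ q * (+ q * (+ p * ((+ p - + 1) * (P + + 2 * (A * A - B * B)))))))
    K₄-count = begin
      + 1536 * + K₄ n            ≡⟨ lemma (+ K₄ n) ⟩
      + 24 * (+ 64 * + K₄ n)     ≡⟨ cong (ℤ._*_ (+ 24)) K₄-sum ⟩
      + 24 * ∑⁴ n F              ≡⟨ Ordering.∑⁴-ordered n clique clique₁₂ clique₂₃ clique₃₄ clique-≡ ⟨
      ∑⁴ n clique                ≡⟨ ∑⁴-n ⟩
      + q * (+ q * (+ q * (+ q * ∑⁴ p clique)))
        ≡⟨ cong (λ z → + q * (+ q * (+ q * (+ q * z)))) (trans ∑-clique (cong (λ z → + p * ((+ p - + 1) * z)) (trans M≡ (cong (ℤ._+_ P) (sym 2[A²-B²]≡X))))) ⟩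
      + q * (+ q * (+ q * (+ q * (+ p * ((+ p - + 1) * (P + + 2 * (A * A - B * B))))))) ∎
      where
      lemma : ∀ k → + 1536 * k ≡ + 24 * (+ 64 * k)
      lemma = solve-∀

    odd-exponent : + (p ^ (2 ℕ.* suc β ∸ 1)) ≡ + q * + q * + p
    odd-exponent = begin
      + (p ^ (2 ℕ.* suc β ∸ 1))  ≡⟨ cong (λ k → + (p ^ k)) (trans (cong (ℕ._+_ β) (cong suc (ℕP.+-identityʳ β))) (ℕP.+-suc β β)) ⟩
      + (p ℕ.* p ^ (β ℕ.+ β))    ≡⟨ cong (λ k → + (p ℕ.* k)) (ℕP.^-distribˡ-+-* p β β) ⟩
      + (p ℕ.* (q ℕ.* q))        ≡⟨ trans (ℤP.pos-* p (q ℕ.* q)) (trans (ℤP.*-comm (+ p) _) (cong (_* + p) (ℤP.pos-* q q))) ⟩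
      + q * + q * + p            ∎

    even-exponent : + (p ^ (2 ℕ.* suc β ∸ 2)) ≡ + q * + q
    even-exponent = begin
      + (p ^ (2 ℕ.* suc β ∸ 2))  ≡⟨ cong (λ k → + (p ^ (k ∸ 1))) (trans (cong (ℕ._+_ β) (cong suc (ℕP.+-identityʳ β))) (ℕP.+-suc β β)) ⟩
      + (p ^ (β ℕ.+ β))          ≡⟨ cong +_ (ℕP.^-distribˡ-+-* p β β) ⟩
      + (q ℕ.* q)                ≡⟨ ℤP.pos-* q q ⟩
      + q * + q                  ∎

  K₄-formula : fromℤ (+ 1536 * + K₄ n) ≡
    fromℤ (+ (p ^ (2 ℕ.* suc β ∸ 1)) * (+ p - + 1)) *ᵍ
      (fromℤ (+ (p ^ (2 ℕ.* suc β ∸ 2)) * ((+ p - + 9) * (+ p - + 9) - + 2 * + p))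
        +ᵍ Jacobi ψ c *ᵍ Jacobi ψ c +ᵍ conj (Jacobi ψ c) *ᵍ conj (Jacobi ψ c))
  K₄-formula = gaussian-product (+ q) (+ p) (+ p - + 1) P A B (+ 1536 * + K₄ n) (+ (p ^ (2 ℕ.* suc β ∸ 1))) (+ (p ^ (2 ℕ.* suc β ∸ 2)))
    (Jacobi ψ c) K₄-count odd-exponent even-exponent jacobi

p%4≡1⇒p∤2 : ∀ {p} → Prime p → p % 4 ≡ 1 → ¬ + p ∣ + 2
p%4≡1⇒p∤2 {p} pr e d with p | pr | e | ℕD.∣⇒≤ (∣⇒∣ᵤ d)
... | 0 | pr₀ | () | _
... | 1 | pr₁ | _ | _ = case pr₁ of λ ()
... | 2 | _ | () | _
... | suc (suc (suc _)) | _ | _ | ℕ.s≤s (ℕ.s≤s ())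

theorem1p2 : (p α : ℕ) → Prime p → p % 4 ≡ 1 → 1 ℕ.≤ α →
    (c ψ : DirichletCharacter (p ^ α)) → HasOrder c 2 → HasOrder ψ 4 →
    fromℤ (+ 1536 ℤ.* + K₄ (p ^ α))
    ≡ fromℤ (+ (p ^ (2 ℕ.* α ∸ 1)) ℤ.* (+ p ℤ.- + 1))
    *ᵍ (fromℤ (+ (p ^ (2 ℕ.* α ∸ 2))
    ℤ.* ((+ p ℤ.- + 9) ℤ.* (+ p ℤ.- + 9) ℤ.- + 2 ℤ.* + p))
    +ᵍ Jacobi ψ c *ᵍ Jacobi ψ c
    +ᵍ conj (Jacobi ψ c) *ᵍ conj (Jacobi ψ c))
theorem1p2 p (suc β) pr p%4≡1 _ c ψ = Main.K₄-formula p β pr (p%4≡1⇒p∤2 pr p%4≡1) c ψ
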